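{- For every atomic flow $A$ there is an atomic flow $B$ such that $A\to_{\mathsf c}^\star B$ and every $\mathsf{ai}$-cycle in $B$ is a fragile cycle.
   Context: An atomic flow is a finite directed acyclic graph whose vertices are labelled interaction (0 upper edges, 2 lower edges), cointeraction (2 upper, 0 lower), weakening (0,1), coweakening (1,0), contraction (2,1) or cocontraction (1,2); edges may also have a dangling upper or lower end; there is a polarity assignment in $\{+,-\}$ with equal polarities on the edges of a (co)contraction and distinct ones on the two edges of a (co)interaction. A path is a sequence of edges $\epsilon_1,\dots,\epsilon_h$ where the lower end of $\epsilon_i$ is the upper end of $\epsilon_{i+1}$, or the reverse of such a sequence. An $\mathsf{ai}$-path is either a path or (recursively) the concatenation $\epsilon_1,\dots,\epsilon_k,\epsilon_{k+1},\dots,\epsilon_h$ of an $\mathsf{ai}$-path ending at an interaction or cointeraction vertex $\nu$ and an $\mathsf{ai}$-path starting at $\nu$, with $\epsilon_k\neq\epsilon_{k+1}$. An $\mathsf{ai}$-cycle is an $\mathsf{ai}$-path from a vertex to itself in which no edge appears twice. A simple edge is an edge whose upper end is an interaction vertex and whose lower end is a cointeraction vertex. A fragile cycle is an $\mathsf{ai}$-cycle containing a simple edge. System $\mathsf c$: (1) a contraction with upper edges $\epsilon_1,\epsilon_2$ whose lower edge is an upper edge of a cointeraction with other upper edge $\epsilon_3$ is replaced by a cocontraction with upper edge $\epsilon_3$ and lower edges $\delta_1,\delta_2$ and cointeractions with upper edges $\{\epsilon_1,\delta_1\}$, $\{\epsilon_2,\delta_2\}$; (2) an interaction with lower edges $\epsilon_3,\epsilon$,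 where $\epsilon$ is the upper edge of a cocontraction with lower edges $\epsilon_1,\epsilon_2$, is replaced by a contraction with lower edge $\epsilon_3$ and upper edges $\delta_1,\delta_2$ and interactions with lower edges $\{\epsilon_1,\delta_1\}$, $\{\epsilon_2,\delta_2\}$; (3) a contraction with upper edges $\epsilon_1,\epsilon_2$ whose lower edge is the upper edge of a cocontraction with lower edges $\epsilon_3,\epsilon_4$ is replaced by two cocontractions with upper edges $\epsilon_1,\epsilon_2$ and two contractions with lower edges $\epsilon_3,\epsilon_4$, with one new edge from each cocontraction to each contraction. $\to_{\mathsf c}^\star$ is the reflexive–transitive closure of one-step rewriting. -}

module Defs where

open import Data.Nat using (ℕ; zero; suc)
open import Data.Fin using (Fin; _≟_)
open import Data.Fin.Base using () renaming (Fin to F)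
open import Data.List using (List; []; _∷_; _++_; [_]; map; reverse; length; filter; allFin)
open import Data.List.Relation.Unary.Unique.Propositional using (Unique)
open import Data.List.Relation.Unary.Any using (Any)
open import Data.Maybe using (Maybe; just; nothing; _>>=_)
import Data.Maybe as M
open import Data.Maybe.Properties using (≡-dec)
open import Data.Product using (Σ; ∃; ∃-syntax; _×_; _,_; proj₁; proj₂)
open import Data.Sum using (_⊎_; inj₁; inj₂)
open import Data.Empty using (⊥)
open import Function.Bundles using (_↔_; Inverse)
open import Relation.Nullary using (¬_; yes; no)
open import Relation.Binary.PropositionalEquality using (_≡_; _≢_)
open import Relation.Binary.Construct.Closure.ReflexiveTransitive using (Star)

data Kind : Set where
  interaction cointeraction weakening coweakening contraction cocontraction : Kind

upperArity : Kind → ℕ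
upperArity interaction   = 0
upperArity cointeraction = 2
upperArity weakening     = 0
upperArity coweakening   = 1
upperArity contraction   = 2
upperArity cocontraction = 1

lowerArity : Kind → ℕ
lowerArity interaction   = 2
lowerArity cointeraction = 0
lowerArity weakening     = 1
lowerArity coweakening   = 0
lowerArity contraction   = 1
lowerArity cocontraction = 2

data Polarity : Set where
  + - : Polarity

-- Raw labelled structures: vertex set V, edge set E.
-- 'up x' is the upper end of edge x (nothing = dangling upper end),
-- 'low x' is its lower end.  An edge x with 'up x ≡ just v' is a lower
-- edge of v; an edge with 'low x ≡ just v' is an upper edge of v.

record Str (V E : Set) : Set where
  field
    lab : V → Kind
    up  : E → Maybe V
    low : E → Maybe V
    pol : E → Polarity

open Str public

data DownPath {V E : Set} (S : Str V E) : List E → Set where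
  one  : (x : E) → DownPath S [ x ]
  cons : (x y : E) (l : List E) (v : V) →
         low S x ≡ just v → up S y ≡ just v →
         DownPath S (y ∷ l) → DownPath S (x ∷ y ∷ l)

StartsWith : {A : Set} → List A → A → Set
StartsWith {A} l a = Σ (List A) λ t → l ≡ a ∷ t

EndsWith : {A : Set} → List A → A → Set
EndsWith {A} l a = Σ (List A) λ t → l ≡ t ++ [ a ]

record Flow : Set where
  field
    nV  : ℕ
    nE  : ℕ
    str : Str (Fin nV) (Fin nE)
  upperEdgeCount : Fin nV → ℕ
  upperEdgeCount v = length (filter (λ x → ≡-dec _≟_ (low str x) (just v)) (allFin nE))
  lowerEdgeCount : Fin nV → ℕ
  lowerEdgeCount v = length (filter (λ x → ≡-dec _≟_ (up str x) (just v)) (allFin nE))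
  Incident : Fin nE → Fin nV → Set
  Incident x v = (up str x ≡ just v) ⊎ (low str x ≡ just v)
  field
    upperArity-ok : ∀ v → upperEdgeCount v ≡ upperArity (lab str v)
    lowerArity-ok : ∀ v → lowerEdgeCount v ≡ lowerArity (lab str v)
    pol-contraction   : ∀ v → lab str v ≡ contraction →
                        ∀ x y → Incident x v → Incident y v → pol str x ≡ pol str y
    pol-cocontraction : ∀ v → lab str v ≡ cocontraction →
                        ∀ x y → Incident x v → Incident y v → pol str x ≡ pol str y
    pol-interaction   : ∀ v → lab str v ≡ interaction →
                        ∀ x y → Incident x v → Incident y v → x ≢ y → pol str x ≢ pol str y
    pol-cointeraction : ∀ v → lab str v ≡ cointeraction →
                        ∀ x y → Incident x v → Incident y v → x ≢ y → pol str x ≢ pol str y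
    acyclic : ∀ (l : List (Fin nE)) (v : Fin nV) (a b : Fin nE) →
              DownPath str l → StartsWith l a → EndsWith l b →
              up str a ≡ just v → low str b ≡ just v → ⊥

open Flow public

record Iso {V E W F : Set} (S : Str V E) (T : Str W F) : Set where
  field
    vIso : V ↔ W
    eIso : E ↔ F
  vto = Inverse.to vIso
  eto = Inverse.to eIso
  field
    lab-pres : ∀ v → lab T (vto v) ≡ lab S v
    up-pres  : ∀ x → up T (eto x) ≡ M.map vto (up S x)
    low-pres : ∀ x → low T (eto x) ≡ M.map vto (low S x)
    pol-pres : ∀ x → pol T (eto x) ≡ pol S x

-- Generic local replacement: remove two vertices c, k and one edge e of
-- A, add new vertices NV and new edges NE (both ends at new vertices),
-- and redirect some ends of kept edges to new vertices.

module Replace (A : Flow) (c k : Fin (nV A)) (e : Fin (nE A))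
               (NV NE : Set) (nlab : NV → Kind) (nup nlow : NE → NV)
               (npol : NE → Polarity)
               (rUp rLow : Fin (nE A) → Maybe NV) where

  KeepV : Set
  KeepV = Σ (Fin (nV A)) λ v → (v ≢ c) × (v ≢ k)

  KeepE : Set
  KeepE = Σ (Fin (nE A)) λ x → x ≢ e

  V' : Set
  V' = KeepV ⊎ NV

  E' : Set
  E' = KeepE ⊎ NE

  embed : Fin (nV A) → Maybe V'
  embed v with v ≟ c | v ≟ k
  ... | no p | no q = just (inj₁ (v , p , q))
  ... | _    | _    = nothing

  endMap : Maybe NV → Maybe (Fin (nV A)) → Maybe V'
  endMap (just w) _ = just (inj₂ w)
  endMap nothing  m = m >>= embed

  result : Str V' E'
  lab result (inj₁ (v , _)) = lab (str A) v
  lab result (inj₂ w)       = nlab w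
  up  result (inj₁ (x , _)) = endMap (rUp x) (up (str A) x)
  up  result (inj₂ n)       = just (inj₂ (nup n))
  low result (inj₁ (x , _)) = endMap (rLow x) (low (str A) x)
  low result (inj₂ n)       = just (inj₂ (nlow n))
  pol result (inj₁ (x , _)) = pol (str A) x
  pol result (inj₂ n)       = npol n

assoc : {n : ℕ} {X : Set} → List (Fin n × X) → Fin n → Maybe X
assoc [] _ = nothing
assoc ((y , w) ∷ l) x with x ≟ y
... | yes _ = just w
... | no  _ = assoc l x

-- Rule (1): contraction c (upper e₁ e₂, lower e) above cointeraction k
-- (upper e, e₃)  ⟶  cocontraction d (upper e₃, lower δ₁ δ₂),
-- cointeractions k₁ (upper e₁, δ₁), k₂ (upper e₂, δ₂).

record Redex1 (A : Flow) : Set where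
  field
    c k : Fin (nV A)
    e e₁ e₂ e₃ : Fin (nE A)
    c-lab : lab (str A) c ≡ contraction
    k-lab : lab (str A) k ≡ cointeraction
    e₁-low : low (str A) e₁ ≡ just c
    e₂-low : low (str A) e₂ ≡ just c
    e₁≢e₂ : e₁ ≢ e₂
    e-up  : up (str A) e ≡ just c
    e-low : low (str A) e ≡ just k
    e₃-low : low (str A) e₃ ≡ just k
    e₃≢e : e₃ ≢ e

data V1 : Set where d₁ k₁ k₂ : V1
data E1 : Set where δ₁ δ₂ : E1

rule1 : (A : Flow) (r : Redex1 A) → Str _ _
rule1 A r = Replace.result A c k e V1 E1 nl nu nlo (λ _ → pol (str A) e₃)
              (λ _ → nothing) (assoc ((e₁ , k₁) ∷ (e₂ , k₂) ∷ (e₃ , d₁) ∷ []))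
  where
  open Redex1 r
  nl : V1 → Kind
  nl d₁ = cocontraction
  nl k₁ = cointeraction
  nl k₂ = cointeraction
  nu : E1 → V1
  nu _ = d₁
  nlo : E1 → V1
  nlo δ₁ = k₁
  nlo δ₂ = k₂

-- Rule (2): interaction i (lower e₃, e) above cocontraction d (upper e,
-- lower e₁ e₂)  ⟶  contraction c (lower e₃, upper δ₁ δ₂),
-- interactions i₁ (lower e₁, δ₁), i₂ (lower e₂, δ₂).

record Redex2 (A : Flow) : Set where
  field
    i d : Fin (nV A)
    e e₁ e₂ e₃ : Fin (nE A)
    i-lab : lab (str A) i ≡ interaction
    d-lab : lab (str A) d ≡ cocontraction
    e-up  : up (str A) e ≡ just i
    e-low : low (str A) e ≡ just d
    e₃-up : up (str A) e₃ ≡ just i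
    e₃≢e : e₃ ≢ e
    e₁-up : up (str A) e₁ ≡ just d
    e₂-up : up (str A) e₂ ≡ just d
    e₁≢e₂ : e₁ ≢ e₂

data V2 : Set where c₀ i₁ i₂ : V2
data E2 : Set where δ₁ δ₂ : E2

rule2 : (A : Flow) (r : Redex2 A) → Str _ _
rule2 A r = Replace.result A i d e V2 E2 nl nu nlo (λ _ → pol (str A) e₃)
              (assoc ((e₃ , c₀) ∷ (e₁ , i₁) ∷ (e₂ , i₂) ∷ [])) (λ _ → nothing)
  where
  open Redex2 r
  nl : V2 → Kind
  nl c₀ = contraction
  nl i₁ = interaction
  nl i₂ = interaction
  nu : E2 → V2
  nu δ₁ = i₁
  nu δ₂ = i₂
  nlo : E2 → V2
  nlo _ = c₀

-- Rule (3): contraction c (upper e₁ e₂, lower e) above cocontraction d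
-- (upper e, lower e₃ e₄)  ⟶  cocontractions d₁ (upper e₁), d₂ (upper e₂),
-- contractions c₃ (lower e₃), c₄ (lower e₄), and one new edge δᵢⱼ from
-- dᵢ to cⱼ for each i, j.

record Redex3 (A : Flow) : Set where
  field
    c d : Fin (nV A)
    e e₁ e₂ e₃ e₄ : Fin (nE A)
    c-lab : lab (str A) c ≡ contraction
    d-lab : lab (str A) d ≡ cocontraction
    e₁-low : low (str A) e₁ ≡ just c
    e₂-low : low (str A) e₂ ≡ just c
    e₁≢e₂ : e₁ ≢ e₂
    e-up  : up (str A) e ≡ just c
    e-low : low (str A) e ≡ just d
    e₃-up : up (str A) e₃ ≡ just d
    e₄-up : up (str A) e₄ ≡ just d
    e₃≢e₄ : e₃ ≢ e₄

data V3 : Set where d₁ d₂ c₃ c₄ : V3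
data E3 : Set where δ₁₃ δ₁₄ δ₂₃ δ₂₄ : E3

rule3 : (A : Flow) (r : Redex3 A) → Str _ _
rule3 A r = Replace.result A c d e V3 E3 nl nu nlo (λ _ → pol (str A) e)
              (assoc ((e₃ , c₃) ∷ (e₄ , c₄) ∷ [])) (assoc ((e₁ , d₁) ∷ (e₂ , d₂) ∷ []))
  where
  open Redex3 r
  nl : V3 → Kind
  nl d₁ = cocontraction
  nl d₂ = cocontraction
  nl c₃ = contraction
  nl c₄ = contraction
  nu : E3 → V3
  nu δ₁₃ = d₁
  nu δ₁₄ = d₁
  nu δ₂₃ = d₂
  nu δ₂₄ = d₂
  nlo : E3 → V3
  nlo δ₁₃ = c₃
  nlo δ₁₄ = c₄
  nlo δ₂₃ = c₃
  nlo δ₂₄ = c₄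

data _→c_ (A B : Flow) : Set where
  step1 : (r : Redex1 A) → Iso (rule1 A r) (str B) → A →c B
  step2 : (r : Redex2 A) → Iso (rule2 A r) (str B) → A →c B
  step3 : (r : Redex3 A) → Iso (rule3 A r) (str B) → A →c B

_→c⋆_ : Flow → Flow → Set
_→c⋆_ = Star _→c_

data Dir : Set where
  ↓ ↑ : Dir

module _ (A : Flow) where

  Step : Set
  Step = Fin (nE A) × Dir

  src : Step → Maybe (Fin (nV A))
  src (x , ↓) = up (str A) x
  src (x , ↑) = low (str A) x

  tgt : Step → Maybe (Fin (nV A))
  tgt (x , ↓) = low (str A) x
  tgt (x , ↑) = up (str A) x

  IsPath : List Step → Set
  IsPath s = (Σ (List (Fin (nE A))) λ l → DownPath (str A) l × (s ≡ map (λ x → (x , ↓)) l))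
           ⊎ (Σ (List (Fin (nE A))) λ l → DownPath (str A) l × (s ≡ reverse (map (λ x → (x , ↑)) l)))

  IsAiVertex : Fin (nV A) → Set
  IsAiVertex ν = (lab (str A) ν ≡ interaction) ⊎ (lab (str A) ν ≡ cointeraction)

  data AiPath : List Step → Set where
    path : ∀ {s} → IsPath s → AiPath s
    join : ∀ (s t : List Step) (a b : Step) (ν : Fin (nV A)) →
           AiPath (s ++ [ a ]) → AiPath (b ∷ t) →
           tgt a ≡ just ν → src b ≡ just ν → IsAiVertex ν →
           proj₁ a ≢ proj₁ b →
           AiPath ((s ++ [ a ]) ++ (b ∷ t))

  record AiCycle (s : List Step) : Set where
    field
      aipath : AiPath s
      v : Fin (nV A)
      first last : Step
      starts : StartsWith s first
      ends   : EndsWith s last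
      src-v  : src first ≡ just v
      tgt-v  : tgt last ≡ just v
      no-repeat : Unique (map proj₁ s)

  SimpleEdge : Fin (nE A) → Set
  SimpleEdge x = Σ (Fin (nV A)) λ i → Σ (Fin (nV A)) λ k →
                 (up (str A) x ≡ just i) × (lab (str A) i ≡ interaction) ×
                 (low (str A) x ≡ just k) × (lab (str A) k ≡ cointeraction)

  FragileCycle : List Step → Set
  FragileCycle s = AiCycle s × Any SimpleEdge (map proj₁ s)

-- Only edges of positive polarity need attention. Reduce every redex whose removed edge is
-- positive. In a flow without such redexes, a positive edge leaving an interaction ends in a
-- cointeraction, and is then simple, or in a contraction, below which no cointeraction or
-- cocontraction can follow. Along an ai-path the polarity, flipped on upward steps, is constant;
-- so, up to reversal, an ai-cycle runs down its positive edges and up its negative ones. By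
-- acyclicity it turns at an interaction and must descend from there to a cointeraction, which is
-- possible only along a simple edge.
--
-- For termination, give each positive edge x a size that is at least 1 above a cointeraction,
-- at least the size below across a contraction, and greater than the sum of the two sizes below
-- across a cocontraction; 3 ^ rank is such an assignment. The edges introduced by the rules can be
-- sized so that kept edges keep theirs, and the sum of the sizes of the positive edges leaving a
-- contraction or an interaction strictly decreases with each reduction.
module Submission where

open import Defs renaming (+ to pos; - to neg)
open import Data.Nat using (ℕ; zero; suc; _+_; _^_; _≤_; _<_; z≤n; s≤s)
open import Data.Nat.Properties hiding (_≟_)
open import Data.Fin using (Fin; zero; suc; _≟_)
open import Data.Fin.Properties using (injective⇒≤; +↔⊎; any?) renaming (suc-injective to Fin-suc-injective)
open import Data.Fin.Induction using (spo-wellFounded; spo-noetherian)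
open import Algebra.Properties.CommutativeMonoid.Sum +-0-commutativeMonoid using (sum)
open import Data.Vec.Functional using (updateAt)
open import Data.Vec.Functional.Properties using (updateAt-updates; updateAt-minimal)
open import Data.List using (List; []; _∷_; _++_; map; reverse; length; filter; allFin; lookup)
import Data.List.Properties as List
open import Data.List.Extrema.Nat using (max; xs≤max)
open import Data.List.Membership.Propositional using (_∈_)
open import Data.List.Membership.Propositional.Properties
  using (∈-lookup; ∈-filter⁺; ∈-allFin; ∈-map⁺; ∈-++⁺ˡ; ∈-++⁺ʳ)
open import Data.List.Relation.Unary.All as All using (All; []; _∷_)
open import Data.List.Relation.Unary.All.Properties using (all-filter)
open import Data.List.Relation.Unary.Any as Any using (Any; here; there; index)
open import Data.List.Relation.Unary.Any.Properties using (lookup-index)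
open import Data.List.Relation.Unary.AllPairs using (AllPairs; []; _∷_)
open import Data.List.Relation.Unary.Unique.Propositional using (Unique)
open import Data.List.Relation.Unary.Unique.Propositional.Properties using (allFin⁺; filter⁺)
open import Data.Maybe as Maybe using (Maybe; just; nothing)
open import Data.Maybe.Properties using (just-injective; ≡-dec)
open import Data.Product using (Σ; ∃; ∃₂; _×_; _,_; proj₁; proj₂)
open import Data.Sum using (_⊎_; inj₁; inj₂; [_,_])
open import Data.Sum.Function.Propositional using (_⊎-↔_)
open import Data.Unit using (⊤; tt)
open import Function using (_∘_; id; const; flip)
open import Function.Construct.Composition using (_↔-∘_)
open import Function.Construct.Symmetry using (↔-sym)
open import Function.Bundles using (_↔_; Inverse; mk↔ₛ′)
open import Induction.WellFounded as WF using (WellFounded; Acc; acc; WfRec; module Subrelation; module FixPoint)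
open import Relation.Binary.Structures using (IsStrictPartialOrder)
open import Relation.Binary.Construct.Closure.Transitive using (TransClosure; [_]; _∷_; transitive; wellFounded⁻)
open import Relation.Binary.Construct.Closure.ReflexiveTransitive using (ε; _◅_)
open import Relation.Binary.PropositionalEquality hiding ([_])
open import Relation.Nullary using (¬_; Dec; yes; no; contradiction)
open import Relation.Unary using (Decidable)
open import Relation.Nullary.Decidable using (¬?; _×-dec_)

-- Counting the elements of a predicate.

private variable
  A B : Set
  P Q : A → Set
  m n o : ℕ

-- An explicit enumeration rather than the length of a filtered list: arities then make sense on
-- sums of kept and new edges too, and can be carried along bijections.
record Card {A : Set} (P : A → Set) (k : ℕ) : Set where
  field
    elt : Fin k → A
    sat : ∀ i → P (elt i)
    inj : ∀ {i j} → elt i ≡ elt j → i ≡ j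
    hit : ∀ x → P x → ∃ λ i → elt i ≡ x

open Card

card-≤ : Card P m → Card P n → m ≤ n
card-≤ C D = injective⇒≤ {f = λ i → proj₁ (hit D _ (sat C i))} λ {i} {j} eq →
  inj C (trans (sym (proj₂ (hit D _ (sat C i)))) (trans (cong (elt D) eq) (proj₂ (hit D _ (sat C j)))))

card-unique : Card P m → Card P n → m ≡ n
card-unique C D = ≤-antisym (card-≤ C D) (card-≤ D C)

lookup-injective : {xs : List A} → Unique xs → ∀ {i j} → lookup xs i ≡ lookup xs j → i ≡ j
lookup-injective (_ ∷ _) {zero}  {zero}  _  = refl
lookup-injective (a ∷ _) {zero}  {suc j} eq = contradiction eq (All.lookup a (∈-lookup j))
lookup-injective (a ∷ _) {suc i} {zero}  eq = contradiction (sym eq) (All.lookup a (∈-lookup i))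
lookup-injective (_ ∷ u) {suc i} {suc j} eq = cong suc (lookup-injective u eq)

card-list : {xs : List A} → Unique xs → (∀ x → P x → x ∈ xs) → All P xs → Card P (length xs)
elt (card-list {xs = xs} u c s) = lookup xs
sat (card-list u c s) i = All.lookup s (∈-lookup i)
inj (card-list u c s) = lookup-injective u
hit (card-list u c s) x p = index (c x p) , sym (lookup-index (c x p))

card-filter : {P : Fin n → Set} (P? : Decidable P) → Card P (length (filter P? (allFin n)))
card-filter P? = card-list (filter⁺ P? (allFin⁺ _)) (λ x → ∈-filter⁺ P? (∈-allFin x))
                           (all-filter P? (allFin _))

-- The preimage must work for every proof `p`, because the enumeration supplies its own proof
-- `sat C i`, not the one at hand.
card-map : (f : ∀ x → P x → B) → (∀ x p → Q (f x p)) →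
           (∀ {x y} p q → f x p ≡ f y q → x ≡ y) →
           (∀ z → Q z → ∃ λ x → P x × (∀ p → f x p ≡ z)) →
           Card P m → Card Q m
elt (card-map f g h s C) i = f (elt C i) (sat C i)
sat (card-map f g h s C) i = g _ _
inj (card-map f g h s C) = inj C ∘ h _ _
hit (card-map f g h s C) z q with s z q
... | x , p , e with hit C x p
... | i , refl = i , e (sat C i)

card0-empty : ∀ {x} → Card P 0 → ¬ P x
card0-empty C p with () ← proj₁ (hit C _ p)

card1-unique : ∀ {x y} → Card P 1 → P x → P y → x ≡ y
card1-unique C p q with hit C _ p | hit C _ q
... | zero , refl | zero , refl = refl

card2-other : ∀ {x} → Card P 2 → P x → ∃ λ y → P y × y ≢ x
card2-other C p with hit C _ p
... | zero     , refl = elt C (suc zero) , sat C _ , λ eq → contradiction (inj C eq) λ ()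
... | suc zero , refl = elt C zero       , sat C _ , λ eq → contradiction (inj C eq) λ ()

card2-pair : Card P 2 → ∃₂ λ x y → P x × P y × x ≢ y
card2-pair C = elt C zero , elt C (suc zero) , sat C _ , sat C _ ,
               λ eq → contradiction (inj C eq) λ ()

card-↔ : {P : A → Set} → (∀ {x} (p q : P x) → p ≡ q) → Card P m → Σ A P ↔ Fin m
card-↔ irr C = mk↔ₛ′ (λ (x , p) → proj₁ (hit C x p)) (λ i → elt C i , sat C i)
  (λ i → inj C (proj₂ (hit C _ (sat C i))))
  (λ (x , p) → pair-≡ (proj₂ (hit C x p)))
  where
  pair-≡ : ∀ {x y p q} → x ≡ y → (x , p) ≡ (y , q)
  pair-≡ refl = cong (_ ,_) (irr _ _)

-- Flow conditions on arbitrary vertex and edge types.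

Sign : Kind → Polarity → Polarity → Set
Sign interaction   p q = p ≢ q
Sign cointeraction p q = p ≢ q
Sign contraction   p q = p ≡ q
Sign cocontraction p q = p ≡ q
Sign weakening     p q = ⊤
Sign coweakening   p q = ⊤

sign-sym : ∀ κ {p q} → Sign κ p q → Sign κ q p
sign-sym interaction   = ≢-sym
sign-sym cointeraction = ≢-sym
sign-sym contraction   = sym
sign-sym cocontraction = sym
sign-sym weakening     = id
sign-sym coweakening   = id

module _ {V E : Set} where

  Incident′ : Str V E → E → V → Set
  Incident′ S x v = (up S x ≡ just v) ⊎ (low S x ≡ just v)

  -- Distinctness is assumed for every kind so that all polarity conditions share one form. At
  -- (co)contractions nothing is lost, since equal edges have equal polarities.
  Polarised : Kind → Str V E → E → E → Set
  Polarised κ S x y = x ≢ y → Sign κ (pol S x) (pol S y)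

-- The flow conditions on an arbitrary edge type, with acyclicity replaced by a rank
-- that decreases along downward paths.
record Good {V E : Set} (S : Str V E) : Set where
  field
    uppers    : ∀ v → Card (λ x → low S x ≡ just v) (upperArity (lab S v))
    lowers    : ∀ v → Card (λ x → up S x ≡ just v) (lowerArity (lab S v))
    polarised : ∀ v {x y} → Incident′ S x v → Incident′ S y v → Polarised (lab S v) S x y
    rank      : E → ℕ
    falls     : ∀ {v x y} → low S x ≡ just v → up S y ≡ just v → rank y < rank x

open Good


-- Edge heights from acyclicity.

module Descent (A : Flow) where

  private S = str A

  _▷_ : Fin (nE A) → Fin (nE A) → Set
  x ▷ y = ∃ λ v → low S x ≡ just v × up S y ≡ just v

  -- The path stops just above y, so that for y = x it is a cycle in the form refuted by acyclic.
  down-path : ∀ {x y} → TransClosure _▷_ x y →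
              ∃ λ l → ∃ λ z → DownPath S (x ∷ l) × EndsWith (x ∷ l) z × z ▷ y
  down-path [ x▷y ] = [] , _ , one _ , ([] , refl) , x▷y
  down-path {x} ((v , p , q) ∷ y▷⁺z) with down-path y▷⁺z
  ... | l , z , d , (t , eq) , z▷ = _ , z , cons x _ l v p q d , (x ∷ t , cong (x ∷_) eq) , z▷

  -- Irreflexivity is exactly acyclicity. On a finite set a strict partial order is well-founded in
  -- both directions, which gives the inductions up and down a flow.
  ▷⁺-isStrictPartialOrder : IsStrictPartialOrder _≡_ (TransClosure _▷_)
  ▷⁺-isStrictPartialOrder = record
    { isEquivalence = isEquivalence
    ; irrefl        = λ { refl → irreflexive }
    ; trans         = transitive _▷_
    ; <-resp-≈      = (λ { refl p → p }) , (λ { refl p → p })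
    }
    where
    irreflexive : ∀ {x} → ¬ TransClosure _▷_ x x
    irreflexive p with down-path p
    ... | l , z , d , e , v , p , q = acyclic A _ v _ z d (l , refl) e q p

  ▷-wellFounded : WellFounded _▷_
  ▷-wellFounded = wellFounded⁻ _▷_ (spo-wellFounded ▷⁺-isStrictPartialOrder)

  ▷-noetherian : WellFounded (flip _▷_)
  ▷-noetherian = Subrelation.wellFounded [_] (spo-noetherian ▷⁺-isStrictPartialOrder)

  _▷?_ : ∀ x y → Dec (x ▷ y)
  x ▷? y with low S x in eq | up S y in eq′
  ... | nothing | _       = no λ { (_ , () , _) }
  ... | just v  | nothing = no λ { (_ , _ , ()) }
  ... | just v  | just w with v ≟ w
  ...   | yes refl = yes (v , refl , refl)
  ...   | no  v≢w  = no λ { (_ , refl , refl) → v≢w refl }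

  height-bound : ∀ x → WfRec (flip _▷_) (const ℕ) x → Fin (nE A) → ℕ
  height-bound x rec y with x ▷? y
  ... | yes x▷y = suc (rec x▷y)
  ... | no  _   = 0

  height-step : ∀ x → WfRec (flip _▷_) (const ℕ) x → ℕ
  height-step x rec = max 0 (map (height-bound x rec) (allFin (nE A)))

  -- Unfolding a well-founded recursion requires that its step depend only on the values of the
  -- recursive calls.
  height-ext : ∀ x {rec rec′ : WfRec (flip _▷_) (const ℕ) x} →
               (∀ {y} (x▷y : x ▷ y) → rec x▷y ≡ rec′ x▷y) → height-step x rec ≡ height-step x rec′
  height-ext x {rec} {rec′} eq = cong (max 0) (List.map-cong bound-ext (allFin (nE A)))
    where
    bound-ext : ∀ y → height-bound x rec y ≡ height-bound x rec′ y
    bound-ext y with x ▷? y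
    ... | yes x▷y = cong suc (eq x▷y)
    ... | no  _   = refl

  -- This is the number of edges, beyond the first, on a longest downward path from the given edge.
  height : Fin (nE A) → ℕ
  height = WF.All.wfRec ▷-noetherian _ (const ℕ) height-step

  height-falls : ∀ {x y} → x ▷ y → height y < height x
  height-falls {x} {y} x▷y =
    -- One unfolding turns the height of `x` into a maximum whose entry at `y` is `suc (height y)`.
    subst (height y <_) (sym (unfold-wfRec {x = x}))
      (≤-trans bound (All.lookup (xs≤max 0 _) (∈-map⁺ _ (∈-allFin y))))
    where
    open FixPoint ▷-noetherian (const ℕ) height-step height-ext
    bound : height y < height-bound x (λ {z} _ → height z) y
    bound with x ▷? y
    ... | yes _  = ≤-refl
    ... | no x⋫y = contradiction x▷y x⋫y

-- From flows to ranked structures and back.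

flow-good : (A : Flow) → Good (str A)
uppers (flow-good A) v =
  subst (Card _) (upperArity-ok A v) (card-filter λ x → ≡-dec _≟_ (low (str A) x) (just v))
lowers (flow-good A) v =
  subst (Card _) (lowerArity-ok A v) (card-filter λ x → ≡-dec _≟_ (up (str A) x) (just v))
polarised (flow-good A) v {x} {y} p q x≢y with lab (str A) v in eq
... | interaction   = pol-interaction A v eq x y p q x≢y
... | cointeraction = pol-cointeraction A v eq x y p q x≢y
... | weakening     = tt
... | coweakening   = tt
... | contraction   = pol-contraction A v eq x y p q
... | cocontraction = pol-cocontraction A v eq x y p q
rank (flow-good A) = Descent.height A
falls (flow-good A) p q = Descent.height-falls A (_ , p , q)

module _ {V E : Set} {S : Str V E} (G : Good S) where

  -- This is how a rank yields `acyclic`: closing the path at a vertex would place its first edge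
  -- strictly below its last.
  rank-monotone : ∀ {x z l} → DownPath S (x ∷ l) → EndsWith (x ∷ l) z → rank G z ≤ rank G x
  rank-monotone (one x)            ([] , refl)    = ≤-refl
  rank-monotone (one x)            (_ ∷ [] , ())
  rank-monotone (one x)            (_ ∷ _ ∷ _ , ())
  rank-monotone (cons x y l v p q d) ([] , ())
  rank-monotone (cons x y l v p q d) (_ ∷ t , eq) =
    ≤-trans (rank-monotone d (t , List.∷-injectiveʳ eq)) (<⇒≤ (falls G p q))

good-flow : ∀ {nV nE} {S : Str (Fin nV) (Fin nE)} → Good S → Flow
good-flow {nV} {nE} {S} G = record
  { nV = nV ; nE = nE ; str = S
  ; upperArity-ok     = λ v → card-unique (card-filter λ x → ≡-dec _≟_ (low S x) (just v)) (uppers G v)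
  ; lowerArity-ok     = λ v → card-unique (card-filter λ x → ≡-dec _≟_ (up S x) (just v)) (lowers G v)
  ; pol-contraction   = λ v eq x y p q → same-pol x y (subst (λ κ → Polarised κ S x y) eq (polarised G v p q))
  ; pol-cocontraction = λ v eq x y p q → same-pol x y (subst (λ κ → Polarised κ S x y) eq (polarised G v p q))
  ; pol-interaction   = λ v eq x y p q → subst (λ κ → Polarised κ S x y) eq (polarised G v p q)
  ; pol-cointeraction = λ v eq x y p q → subst (λ κ → Polarised κ S x y) eq (polarised G v p q)
  ; acyclic = λ { _ v a b d (l , refl) e p q → <⇒≱ (falls G q p) (rank-monotone G d e) }
  }
  where
  same-pol : ∀ x y → (x ≢ y → pol S x ≡ pol S y) → pol S x ≡ pol S y
  same-pol x y eq with x ≟ y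
  ... | yes refl = refl
  ... | no x≢y   = eq x≢y

-- Potentials and their totals.

module _ {V E : Set} where

  -- The strict inequality at a cocontraction makes rules (2) and (3) lower the total; the unit at a
  -- cointeraction does so for rule (1).
  Bound : Kind → Str V E → (E → ℕ) → E → V → Set
  Bound cointeraction S s x v = 1 ≤ s x
  Bound contraction   S s x v = ∀ y → up S y ≡ just v → s y ≤ s x
  Bound cocontraction S s x v = ∀ y z → y ≢ z → up S y ≡ just v → up S z ≡ just v → s y + s z < s x
  Bound interaction   S s x v = ⊤
  Bound weakening     S s x v = ⊤
  Bound coweakening   S s x v = ⊤

  topKind : Str V E → E → Maybe Kind
  topKind S x = Maybe.map (lab S) (up S x)

-- The size of a positive edge bounds the number of cocontractions and cointeractions
-- in the unfolding below it.
record Potential {V E : Set} (S : Str V E) : Set where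
  field
    size  : E → ℕ
    bound : ∀ {x v} → pol S x ≡ pos → low S x ≡ just v → Bound (lab S v) S size x v

open Potential

-- The edge removed by a positive redex always leaves a contraction or an interaction, so these
-- edges are counted. Edges below a cocontraction are free until a reduction places another vertex
-- above them.
weight : Polarity → Maybe Kind → ℕ → ℕ
weight pos (just contraction) n = n
weight pos (just interaction) n = n
weight _   _                  _ = 0

weight-nothing : ∀ p s → weight p nothing s ≡ 0
weight-nothing pos s = refl
weight-nothing neg s = refl

load : {V E : Set} (S : Str V E) → Potential S → E → ℕ
load S P x = weight (pol S x) (topKind S x) (size P x)

total : (A : Flow) → Potential (str A) → ℕ
total A P = sum (load (str A) P)

-- Transport of structures to finite index sets.

module Relabel {V E : Set} (S : Str V E) (vi : V ↔ Fin n) (ei : E ↔ Fin m) where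

  private
    module V = Inverse vi
    module E = Inverse ei

  relabel : Str (Fin n) (Fin m)
  lab relabel w = lab S (V.from w)
  up  relabel i = Maybe.map V.to (up S (E.from i))
  low relabel i = Maybe.map V.to (low S (E.from i))
  pol relabel i = pol S (E.from i)

  relabel-iso : Iso S relabel
  relabel-iso = record
    { vIso     = vi
    ; eIso     = ei
    ; lab-pres = λ v → cong (lab S) (V.strictlyInverseʳ v)
    ; up-pres  = λ x → cong (Maybe.map V.to ∘ up S) (E.strictlyInverseʳ x)
    ; low-pres = λ x → cong (Maybe.map V.to ∘ low S) (E.strictlyInverseʳ x)
    ; pol-pres = λ x → cong (pol S) (E.strictlyInverseʳ x)
    }

  end⁺ : ∀ {w} (f : E → Maybe V) x → f x ≡ just (V.from w) → Maybe.map V.to (f (E.from (E.to x))) ≡ just w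
  end⁺ f x eq = trans (cong (Maybe.map V.to ∘ f) (E.strictlyInverseʳ x))
                (trans (cong (Maybe.map V.to) eq) (cong just (V.strictlyInverseˡ _)))

  end⁻ : ∀ {w} (m : Maybe V) → Maybe.map V.to m ≡ just w → m ≡ just (V.from w)
  end⁻ (just v) refl = cong just (sym (V.strictlyInverseʳ v))

  to-injective : ∀ {x y} → E.to x ≡ E.to y → x ≡ y
  to-injective eq = trans (sym (E.strictlyInverseʳ _)) (trans (cong E.from eq) (E.strictlyInverseʳ _))

  from-injective : ∀ {i j} → E.from i ≡ E.from j → i ≡ j
  from-injective eq = trans (sym (E.strictlyInverseˡ _)) (trans (cong E.to eq) (E.strictlyInverseˡ _))

  relabel-card : ∀ {w} (f : E → Maybe V) → Card (λ x → f x ≡ just (V.from w)) o →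
                 Card (λ i → Maybe.map V.to (f (E.from i)) ≡ just w) o
  relabel-card f = card-map (λ x _ → E.to x) (end⁺ f) (λ _ _ → to-injective)
                            (λ i eq → E.from i , end⁻ _ eq , λ _ → E.strictlyInverseˡ i)

  relabel-good : Good S → Good relabel
  uppers (relabel-good G) w = relabel-card (low S) (uppers G (V.from w))
  lowers (relabel-good G) w = relabel-card (up S) (lowers G (V.from w))
  polarised (relabel-good G) w p q i≢j =
    polarised G (V.from w) (incident⁻ p) (incident⁻ q) (i≢j ∘ from-injective)
    where
    incident⁻ : ∀ {i} → Incident′ relabel i w → Incident′ S (E.from i) (V.from w)
    incident⁻ (inj₁ p) = inj₁ (end⁻ _ p)
    incident⁻ (inj₂ p) = inj₂ (end⁻ _ p)
  rank (relabel-good G) i = rank G (E.from i)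
  falls (relabel-good G) p q = falls G (end⁻ _ p) (end⁻ _ q)

  relabel-potential : Potential S → Potential relabel
  size (relabel-potential P) i = size P (E.from i)
  bound (relabel-potential P) {x} {w} p q = transfer (lab S (V.from w)) (bound P p (end⁻ _ q))
    where
    transfer : ∀ κ → Bound κ S (size P) (E.from x) (V.from w) →
               Bound κ relabel (size P ∘ E.from) x w
    transfer cointeraction b = b
    transfer contraction   b = λ y p → b _ (end⁻ _ p)
    transfer cocontraction b = λ y z y≢z p q → b _ _ (y≢z ∘ from-injective) (end⁻ _ p) (end⁻ _ q)
    transfer interaction   b = tt
    transfer weakening     b = tt
    transfer coweakening   b = tt

  relabel-load : (P : Potential S) → ∀ i → load relabel (relabel-potential P) i ≡ load S P (E.from i)
  relabel-load P i with up S (E.from i)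
  ... | nothing = refl
  ... | just v  =
    cong (λ u → weight (pol S (E.from i)) (just (lab S u)) (size P (E.from i))) (V.strictlyInverseʳ v)

-- Comparison of finite sums.

sum-updateAt : ∀ (x : Fin n) c (g : Fin n → ℕ) → sum (updateAt g x (const c)) + g x ≡ sum g + c
sum-updateAt zero    c g = begin
  (c + t) + g zero ≡⟨ +-assoc c t (g zero) ⟩
  c + (t + g zero) ≡⟨ +-comm c _ ⟩
  (t + g zero) + c ≡⟨ cong (_+ c) (+-comm t (g zero)) ⟩
  (g zero + t) + c ∎
  where
  open ≡-Reasoning
  t = sum (g ∘ suc)
sum-updateAt (suc x) c g = begin
  (g zero + sum (updateAt (g ∘ suc) x (const c))) + g (suc x) ≡⟨ +-assoc (g zero) _ _ ⟩
  g zero + (sum (updateAt (g ∘ suc) x (const c)) + g (suc x)) ≡⟨ cong (g zero +_) (sum-updateAt x c (g ∘ suc)) ⟩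
  g zero + (sum (g ∘ suc) + c)                                ≡⟨ +-assoc (g zero) _ _ ⟨
  (g zero + sum (g ∘ suc)) + c                                ∎
  where open ≡-Reasoning

-- By induction on the index set of `f`: the entry of `g` matched to the first index is spent and
-- overwritten by 0, and injectivity of `φ` keeps the later indices away from it.
sum-≤ : (φ : Fin m → Maybe (Fin n)) → (∀ {i j x} → φ i ≡ just x → φ j ≡ just x → i ≡ j) →
        (f : Fin m → ℕ) (g : Fin n → ℕ) →
        (∀ i → φ i ≡ nothing → f i ≡ 0) → (∀ i {x} → φ i ≡ just x → f i ≤ g x) → sum f ≤ sum g
sum-≤ {zero}  φ φ-inj f g f≡0 f≤g = z≤n
sum-≤ {suc m} φ φ-inj f g f≡0 f≤g with φ zero in eq
... | nothing rewrite f≡0 zero eq =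
  sum-≤ (φ ∘ suc) (λ p q → Fin-suc-injective (φ-inj p q)) (f ∘ suc) g (f≡0 ∘ suc) (f≤g ∘ suc)
... | just x = begin
  f zero + sum (f ∘ suc) ≤⟨ +-mono-≤ (f≤g zero eq) rec ⟩
  g x + sum g′           ≡⟨ +-comm (g x) _ ⟩
  sum g′ + g x           ≡⟨ sum-updateAt x 0 g ⟩
  sum g + 0              ≡⟨ +-identityʳ _ ⟩
  sum g                  ∎
  where
  open ≤-Reasoning
  g′ = updateAt g x (const 0)
  rest : ∀ i {y} → φ (suc i) ≡ just y → f (suc i) ≤ g′ y
  rest i {y} p = subst (f (suc i) ≤_)
    (sym (updateAt-minimal y x g λ { refl → contradiction (φ-inj p eq) λ () })) (f≤g (suc i) p)
  rec : sum (f ∘ suc) ≤ sum g′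
  rec = sum-≤ (φ ∘ suc) (λ p q → Fin-suc-injective (φ-inj p q)) (f ∘ suc) g′ (f≡0 ∘ suc) rest

-- Local replacement in general.

allPairs-lookup : {R : A → A → Set} → (∀ {x y} → R x y → R y x) → ∀ {xs x y} → AllPairs R xs →
                  x ∈ xs → y ∈ xs → x ≢ y → R x y
allPairs-lookup s (p ∷ ps) (here refl) (here refl) x≢y = contradiction refl x≢y
allPairs-lookup s (p ∷ ps) (here refl) (there j)   x≢y = All.lookup p j
allPairs-lookup s (p ∷ ps) (there i)   (here refl) x≢y = s (All.lookup p i)
allPairs-lookup s (p ∷ ps) (there i)   (there j)   x≢y = allPairs-lookup s ps i j x≢y

module Replacement (A : Flow) (c k : Fin (nV A)) (e : Fin (nE A)) {NV NE : Set}
  (nl : NV → Kind) (nu nd : NE → NV) (np : NE → Polarity) (rU rL : Fin (nE A) → Maybe NV) where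

  open Replace A c k e NV NE nl nu nd np rU rL

  private
    S = str A
    G = flow-good A

  embed-kept : ∀ {v} (p : v ≢ c) (q : v ≢ k) → embed v ≡ just (inj₁ (v , p , q))
  embed-kept {v} p q with v ≟ c | v ≟ k
  ... | yes eq | _      = contradiction eq p
  ... | no _   | yes eq = contradiction eq q
  ... | no _   | no _   = refl

  embed-kept⁻ : ∀ v {u} → embed v ≡ just u → ∃₂ λ p q → u ≡ inj₁ (v , p , q)
  embed-kept⁻ v eq with v ≟ c | v ≟ k
  embed-kept⁻ v refl | no p  | no q  = p , q , refl
  embed-kept⁻ v ()   | no _  | yes _
  embed-kept⁻ v ()   | yes _ | _

  end-old : ∀ {r m v} (p : v ≢ c) (q : v ≢ k) → r ≡ nothing → m ≡ just v →
            endMap r m ≡ just (inj₁ (v , p , q))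
  end-old p q refl refl = embed-kept p q

  end-old⁻ : ∀ r m {v} → endMap r m ≡ just (inj₁ v) → m ≡ just (proj₁ v)
  end-old⁻ nothing (just v) eq with embed-kept⁻ v eq
  ... | _ , _ , refl = refl

  end-new⁻ : ∀ r m {w} → endMap r m ≡ just (inj₂ w) → r ≡ just w
  end-new⁻ (just _) m        refl = refl
  end-new⁻ nothing  (just v) eq   with embed-kept⁻ v eq
  ... | _ , _ , ()

  -- x ends at the new vertex w, for r = rU, f = nu or r = rL, f = nd.
  At : (Fin (nE A) → Maybe NV) → (NE → NV) → NV → E' → Set
  At r f w (inj₁ (x , _)) = r x ≡ just w
  At r f w (inj₂ n)       = f n ≡ w

  at-low⁻ : ∀ {w} x → low result x ≡ just (inj₂ w) → At rL nd w x
  at-low⁻ (inj₁ (x , _)) eq   = end-new⁻ (rL x) _ eq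
  at-low⁻ (inj₂ n)       refl = refl

  at-up⁻ : ∀ {w} x → up result x ≡ just (inj₂ w) → At rU nu w x
  at-up⁻ (inj₁ (x , _)) eq   = end-new⁻ (rU x) _ eq
  at-up⁻ (inj₂ n)       refl = refl

  at-low⁺ : ∀ {w x} → At rL nd w x → low result x ≡ just (inj₂ w)
  at-low⁺ {x = inj₁ _} eq rewrite eq = refl
  at-low⁺ {x = inj₂ _} refl = refl

  at-up⁺ : ∀ {w x} → At rU nu w x → up result x ≡ just (inj₂ w)
  at-up⁺ {x = inj₁ _} eq rewrite eq = refl
  at-up⁺ {x = inj₂ _} refl = refl

  extend : (Fin (nE A) → ℕ) → (NE → ℕ) → E' → ℕ
  extend f h (inj₁ (x , _)) = f x
  extend f h (inj₂ n)       = h n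

  incident-old⁻ : ∀ x {v} → Incident′ result x (inj₁ v) →
                  ∃₂ λ y p → x ≡ inj₁ (y , p) × Incident′ S y (proj₁ v)
  incident-old⁻ (inj₁ (y , p)) (inj₁ q)  = y , p , refl , inj₁ (end-old⁻ (rU y) _ q)
  incident-old⁻ (inj₁ (y , p)) (inj₂ q)  = y , p , refl , inj₂ (end-old⁻ (rL y) _ q)
  incident-old⁻ (inj₂ _)       (inj₁ ())
  incident-old⁻ (inj₂ _)       (inj₂ ())

  -- What remains to be checked for a particular rule: redirection leaves the edges at kept vertices
  -- alone, and the upper and lower edges of each new vertex are listed, so that arities, signs and
  -- ranks can be verified entry by entry.
  record Frame : Set where
    field
      e-up           : up S e ≡ just c
      e-low          : low S e ≡ just k
      rU-fix         : ∀ {x v} → up S x ≡ just v → v ≢ c → v ≢ k → rU x ≡ nothing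
      rL-fix         : ∀ {x v} → low S x ≡ just v → v ≢ c → v ≢ k → rL x ≡ nothing
      ups downs      : NV → List E'
      ups-unique     : ∀ w → Unique (ups w)
      downs-unique   : ∀ w → Unique (downs w)
      ups-complete   : ∀ {w} x → At rL nd w x → x ∈ ups w
      downs-complete : ∀ {w} x → At rU nu w x → x ∈ downs w
      ups-sound      : ∀ w → All (At rL nd w) (ups w)
      downs-sound    : ∀ w → All (At rU nu w) (downs w)
      ups-arity      : ∀ w → length (ups w) ≡ upperArity (nl w)
      downs-arity    : ∀ w → length (downs w) ≡ lowerArity (nl w)
      signs          : ∀ w → AllPairs (λ x y → Sign (nl w) (pol result x) (pol result y)) (ups w ++ downs w)
      -- Old ranks are raised by one, which makes room for a new edge of rank 0 below any kept edge.
      new-rank       : NE → ℕ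
      new-falls      : ∀ w → All (λ x → All (λ y → extend (suc ∘ rank G) new-rank y <
                                                   extend (suc ∘ rank G) new-rank x) (downs w)) (ups w)

  module _ (F : Frame) where

    open Frame F

    result-good : Good result
    uppers result-good (inj₂ w) = subst (Card _) (ups-arity w)
      (card-list (ups-unique w) (λ x → ups-complete x ∘ at-low⁻ x) (All.map at-low⁺ (ups-sound w)))
    uppers result-good (inj₁ (v , v≢c , v≢k)) =
      -- An upper edge of the kept vertex `v` is not `e`, whose lower end is the removed vertex `k`.
      card-map (λ x p → inj₁ (x , λ { refl → v≢k (just-injective (trans (sym p) e-low)) }))
               (λ x p → end-old v≢c v≢k (rL-fix p v≢c v≢k) p)
               (λ { _ _ refl → refl })
               (λ { (inj₁ (x , _)) p → x , end-old⁻ (rL x) _ p , λ _ → refl })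
               (uppers G v)
    lowers result-good (inj₂ w) = subst (Card _) (downs-arity w)
      (card-list (downs-unique w) (λ x → downs-complete x ∘ at-up⁻ x) (All.map at-up⁺ (downs-sound w)))
    lowers result-good (inj₁ (v , v≢c , v≢k)) =
      card-map (λ x p → inj₁ (x , λ { refl → v≢c (just-injective (trans (sym p) e-up)) }))
               (λ x p → end-old v≢c v≢k (rU-fix p v≢c v≢k) p)
               (λ { _ _ refl → refl })
               (λ { (inj₁ (x , _)) p → x , end-old⁻ (rU x) _ p , λ _ → refl })
               (lowers G v)
    polarised result-good (inj₂ w) {x} {y} p q =
      allPairs-lookup (sign-sym (nl w)) (signs w) (incident-new x p) (incident-new y q)
      where
      incident-new : ∀ x → Incident′ result x (inj₂ w) → x ∈ ups w ++ downs w
      incident-new x (inj₁ p) = ∈-++⁺ʳ (ups w) (downs-complete x (at-up⁻ x p))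
      incident-new x (inj₂ p) = ∈-++⁺ˡ (ups-complete x (at-low⁻ x p))
    polarised result-good (inj₁ v) {x′} {y′} p q with incident-old⁻ x′ p | incident-old⁻ y′ q
    ... | x , _ , refl , p′ | y , _ , refl , q′ =
      λ x≢y → polarised G (proj₁ v) p′ q′ λ { refl → x≢y refl }
    rank result-good = extend (suc ∘ rank G) new-rank
    falls result-good {inj₂ w} {x} {y} p q =
      All.lookup (All.lookup (new-falls w) (ups-complete x (at-low⁻ x p))) (downs-complete y (at-up⁻ y q))
    -- New edges have both ends at new vertices, so only old edges meet at a kept vertex.
    falls result-good {inj₁ v} {inj₁ (x , _)} {inj₁ (y , _)} p q =
      s≤s (falls G (end-old⁻ (rL x) _ p) (end-old⁻ (rU y) _ q))

    -- At a kept vertex the same edges meet with the same sizes, so the old bound survives; only the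
    -- new vertices need an argument.
    result-potential : (P : Potential S) (h : NE → ℕ) →
      (∀ w → All (λ x → pol result x ≡ pos → Bound (nl w) result (extend (size P) h) x (inj₂ w)) (ups w)) →
      Potential result
    size (result-potential P h new) = extend (size P) h
    bound (result-potential P h new) {x} {inj₂ w} p q = All.lookup (new w) (ups-complete x (at-low⁻ x q)) p
    bound (result-potential P h new) {inj₁ (x , x≢e)} {inj₁ v} p q =
      transfer (lab S (proj₁ v)) (bound P p (end-old⁻ (rL x) _ q))
      where
      transfer : ∀ κ → Bound κ S (size P) x (proj₁ v) →
                 Bound κ result (extend (size P) h) (inj₁ (x , x≢e)) (inj₁ v)
      transfer cointeraction b = b
      transfer contraction   b = λ { (inj₁ (y , _)) p → b y (end-old⁻ (rU y) _ p) }
      transfer cocontraction b = λ { (inj₁ (y , _)) (inj₁ (z , _)) y≢z p q →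
        b y z (λ { refl → y≢z refl }) (end-old⁻ (rU y) _ p) (end-old⁻ (rU z) _ q) }
      transfer interaction   b = tt
      transfer weakening     b = tt
      transfer coweakening   b = tt

  -- A removed upper end need not be excluded: the edge would then dangle, and dangling edges have
  -- load 0.
  load-old : (P : Potential S) (P′ : Potential result) → ∀ {x} {p : x ≢ e} →
             size P′ (inj₁ (x , p)) ≡ size P x → rU x ≡ nothing → load result P′ (inj₁ (x , p)) ≤ load S P x
  load-old P P′ {x} eq r rewrite eq | r with up S x
  ... | nothing = ≤-refl
  ... | just v with v ≟ c | v ≟ k
  ...   | no _  | no _  = ≤-refl
  ...   | no _  | yes _ = ≤-trans (≤-reflexive (weight-nothing (pol S x) _)) z≤n
  ...   | yes _ | _     = ≤-trans (≤-reflexive (weight-nothing (pol S x) _)) z≤n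

  module _ {a b : ℕ} (NV↔ : NV ↔ Fin a) (NE↔ : NE ↔ Fin b) where

    private
      keptV : Card (λ v → v ≢ c × v ≢ k) _
      keptV = card-filter λ v → ¬? (v ≟ c) ×-dec ¬? (v ≟ k)

      keptE : Card (_≢ e) _
      keptE = card-filter λ x → ¬? (x ≟ e)

      -- Inequalities are functions into the empty type, and any two of these are definitionally
      -- equal, so `refl` proves irrelevance.
      V'↔ = ↔-sym +↔⊎ ↔-∘ (card-↔ (λ _ _ → refl) keptV ⊎-↔ NV↔)
      E'↔ = ↔-sym +↔⊎ ↔-∘ (card-↔ (λ _ _ → refl) keptE ⊎-↔ NE↔)

      module R = Relabel result V'↔ E'↔
      module E = Inverse E'↔

    old : E' → Maybe (Fin (nE A))
    old (inj₁ (x , _)) = just x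
    old (inj₂ _)       = nothing

    old⁻ : ∀ y {x} → old y ≡ just x → ∃ λ p → y ≡ inj₁ (x , p)
    old⁻ (inj₁ (x , p)) refl = p , refl

    -- The function `g` is a ceiling for the loads of kept edges after the reduction. As `e`
    -- disappears, its share `g e` may pay for increases elsewhere.
    contract : Good result → (P : Potential S) (P′ : Potential result) (g : Fin (nE A) → ℕ) →
      (∀ {x} p → load result P′ (inj₁ (x , p)) ≤ g x) → (∀ n → load result P′ (inj₂ n) ≡ 0) →
      sum g < total A P + g e →
      Σ Flow λ B → Iso result (str B) × Σ (Potential (str B)) λ Q → total B Q < total A P
    contract G′ P P′ g old≤ new≡0 lt =
      good-flow (R.relabel-good G′) , R.relabel-iso , R.relabel-potential P′ ,
      +-cancelˡ-< (g e) _ _ (begin-strict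
        g e + sum (load R.relabel (R.relabel-potential P′)) ≤⟨ sum-≤ φ φ-inj f g f≡0 f≤g ⟩
        sum g             <⟨ lt ⟩
        total A P + g e   ≡⟨ +-comm _ (g e) ⟩
        g e + total A P   ∎)
      where
      open ≤-Reasoning
      -- The additional index `zero` stands for the removed edge, so that `g e` occurs on both sides
      -- and cancels.
      φ : Fin (suc _) → Maybe (Fin (nE A))
      φ zero    = just e
      φ (suc i) = old (E.from i)
      f : Fin (suc _) → ℕ
      f zero    = g e
      f (suc i) = load R.relabel (R.relabel-potential P′) i
      φ-inj : ∀ {i j x} → φ i ≡ just x → φ j ≡ just x → i ≡ j
      φ-inj {zero}  {zero}  p    q = refl
      φ-inj {zero}  {suc j} refl q = contradiction refl (proj₁ (old⁻ (E.from j) q))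
      φ-inj {suc i} {zero}  p refl = contradiction refl (proj₁ (old⁻ (E.from i) p))
      φ-inj {suc i} {suc j} p    q with old⁻ (E.from i) p | old⁻ (E.from j) q
      ... | _ , p′ | _ , q′ = cong suc (R.from-injective (trans p′ (sym q′)))
      f≡0 : ∀ i → φ i ≡ nothing → f i ≡ 0
      f≡0 zero    ()
      f≡0 (suc i) p = trans (R.relabel-load P′ i) (new-case (E.from i) p)
        where
        new-case : ∀ y → old y ≡ nothing → load result P′ y ≡ 0
        new-case (inj₂ n) _ = new≡0 n
      f≤g : ∀ i {x} → φ i ≡ just x → f i ≤ g x
      f≤g zero    refl = ≤-refl
      f≤g (suc i) p = ≤-trans (≤-reflexive (R.relabel-load P′ i)) (old-case (E.from i) p)
        where
        old-case : ∀ y {x} → old y ≡ just x → load result P′ y ≤ g x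
        old-case (inj₁ (x , x≢e)) refl = old≤ x≢e

-- rule1, rule2 and rule3 hide their labels and end maps in where blocks; unification recovers them.
FrameOf : ∀ (A : Flow) c k e {NV NE nl nu nd np rU rL}
          (T : Str (Replace.V' A c k e NV NE nl nu nd np rU rL) (Replace.E' A c k e NV NE nl nu nd np rU rL)) →
          Replace.result A c k e NV NE nl nu nd np rU rL ≡ T → Set
FrameOf A c k e {nl = nl} {nu} {nd} {np} {rU} {rL} _ _ = Replacement.Frame A c k e nl nu nd np rU rL

-- Association tables and elementary facts on polarities.

module _ {X : Set} where

  assoc-∈ : ∀ (l : List (Fin n × X)) x {w} → assoc l x ≡ just w → (x , w) ∈ l
  assoc-∈ ((y , u) ∷ l) x eq with x ≟ y
  assoc-∈ ((y , u) ∷ l) x refl | yes refl = here refl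
  assoc-∈ ((y , u) ∷ l) x eq   | no _     = there (assoc-∈ l x eq)

  assoc-unique : ∀ {l : List (Fin n × X)} {x w} → Unique (map proj₁ l) → (x , w) ∈ l → assoc l x ≡ just w
  assoc-unique {l = (y , u) ∷ l} {x} (y∉ ∷ _) p with x ≟ y | p
  ... | yes _    | here refl = refl
  ... | yes refl | there q   = contradiction refl (All.lookup y∉ (∈-map⁺ proj₁ q))
  ... | no x≢y   | here refl = contradiction refl x≢y
  assoc-unique (_ ∷ u) p | no _ | there q = assoc-unique u q

  assoc-nothing : ∀ (l : List (Fin n × X)) x → (∀ w → ¬ (x , w) ∈ l) → assoc l x ≡ nothing
  assoc-nothing l x ∉l with assoc l x in eq
  ... | nothing = refl
  ... | just w  = contradiction (assoc-∈ l x eq) (∉l w)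

pos⇒≢neg : ∀ {p q} → p ≡ pos → q ≡ neg → p ≢ q
pos⇒≢neg refl refl ()

≢pos⇒neg : ∀ {p} → p ≢ pos → p ≡ neg
≢pos⇒neg {pos} p≢ = contradiction refl p≢
≢pos⇒neg {neg} p≢ = refl

weight-neg : ∀ {p} t s → p ≡ neg → weight p t s ≡ 0
weight-neg t s refl = refl

just-≢ : {x y : A} {m : Maybe A} → x ≢ y → m ≡ just x → m ≢ just y
just-≢ x≢y p q = x≢y (just-injective (trans (sym p) q))

ends-≢ : {f : A → Maybe B} {x y : A} {u v : B} → u ≢ v → f x ≡ just u → f y ≡ just v → x ≢ y
ends-≢ u≢v p q refl = just-≢ u≢v p q

-- Rule (1): contraction above cointeraction.

V1↔ : V1 ↔ Fin 3
V1↔ = mk↔ₛ′ (λ { d₁ → zero ; k₁ → suc zero ; k₂ → suc (suc zero) })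
            (λ { zero → d₁ ; (suc zero) → k₁ ; (suc (suc zero)) → k₂ })
            (λ { zero → refl ; (suc zero) → refl ; (suc (suc zero)) → refl })
            (λ { d₁ → refl ; k₁ → refl ; k₂ → refl })

E1↔ : E1 ↔ Fin 2
E1↔ = mk↔ₛ′ (λ { δ₁ → zero ; δ₂ → suc zero }) (λ { zero → δ₁ ; (suc zero) → δ₂ })
            (λ { zero → refl ; (suc zero) → refl }) (λ { δ₁ → refl ; δ₂ → refl })

module Rule1 (A : Flow) (r : Redex1 A) (e-pos : pol (str A) (Redex1.e r) ≡ pos) where

  open Redex1 r

  private
    S = str A
    G = flow-good A
    T = rule1 A r
    E′ = Σ (Fin (nE A)) (_≢ e) ⊎ E1

  c≢k : c ≢ k
  c≢k refl with () ← trans (sym c-lab) k-lab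

  e₁≢e : e₁ ≢ e
  e₁≢e = ends-≢ {f = low S} c≢k e₁-low e-low

  e₂≢e : e₂ ≢ e
  e₂≢e = ends-≢ {f = low S} c≢k e₂-low e-low

  e₁-pos : pol S e₁ ≡ pos
  e₁-pos = trans (pol-contraction A c c-lab e₁ e (inj₂ e₁-low) (inj₁ e-up)) e-pos

  e₂-pos : pol S e₂ ≡ pos
  e₂-pos = trans (pol-contraction A c c-lab e₂ e (inj₂ e₂-low) (inj₁ e-up)) e-pos

  e₃-neg : pol S e₃ ≡ neg
  e₃-neg = ≢pos⇒neg λ eq →
    pol-cointeraction A k k-lab e₃ e (inj₂ e₃-low) (inj₂ e-low) e₃≢e (trans eq (sym e-pos))

  table : List (Fin (nE A) × V1)
  table = (e₁ , k₁) ∷ (e₂ , k₂) ∷ (e₃ , d₁) ∷ []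

  table-unique : Unique (map proj₁ table)
  table-unique = (e₁≢e₂ ∷ ends-≢ {f = low S} c≢k e₁-low e₃-low ∷ [])
               ∷ (ends-≢ {f = low S} c≢k e₂-low e₃-low ∷ []) ∷ [] ∷ []

  frame : FrameOf A c k e T refl
  frame = record
    { e-up           = e-up
    ; e-low          = e-low
    ; rU-fix         = λ _ _ _ → refl
    ; rL-fix         = λ {x} p v≢c v≢k → assoc-nothing table x λ
        { w (here refl)                 → just-≢ v≢c p e₁-low
        ; w (there (here refl))         → just-≢ v≢c p e₂-low
        ; w (there (there (here refl))) → just-≢ v≢k p e₃-low }
    ; ups            = ups
    ; downs          = downs
    ; ups-unique     = λ { d₁ → [] ∷ [] ; k₁ → ((λ ()) ∷ []) ∷ [] ∷ [] ; k₂ → ((λ ()) ∷ []) ∷ [] ∷ [] }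
    ; downs-unique   = λ { d₁ → ((λ ()) ∷ []) ∷ [] ∷ [] ; k₁ → [] ; k₂ → [] }
    ; ups-complete   = λ
        { (inj₁ (x , p)) eq   → old-ups p (assoc-∈ table x eq)
        ; (inj₂ δ₁)      refl → there (here refl)
        ; (inj₂ δ₂)      refl → there (here refl) }
    ; downs-complete = λ { (inj₂ δ₁) refl → here refl ; (inj₂ δ₂) refl → there (here refl) }
    ; ups-sound      = λ
        { d₁ → assoc-unique table-unique (there (there (here refl))) ∷ []
        ; k₁ → assoc-unique table-unique (here refl) ∷ refl ∷ []
        ; k₂ → assoc-unique table-unique (there (here refl)) ∷ refl ∷ [] }
    ; downs-sound    = λ { d₁ → refl ∷ refl ∷ [] ; k₁ → [] ; k₂ → [] }
    ; ups-arity      = λ { d₁ → refl ; k₁ → refl ; k₂ → refl }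
    ; downs-arity    = λ { d₁ → refl ; k₁ → refl ; k₂ → refl }
    ; signs          = λ
        { d₁ → (refl ∷ refl ∷ []) ∷ (refl ∷ []) ∷ [] ∷ []
        ; k₁ → (pos⇒≢neg e₁-pos e₃-neg ∷ []) ∷ [] ∷ []
        ; k₂ → (pos⇒≢neg e₂-pos e₃-neg ∷ []) ∷ [] ∷ [] }
    -- The new edges end in cointeractions, so nothing lies below them.
    ; new-rank       = λ _ → 0
    ; new-falls      = λ { d₁ → (s≤s z≤n ∷ s≤s z≤n ∷ []) ∷ [] ; k₁ → [] ∷ [] ∷ [] ; k₂ → [] ∷ [] ∷ [] }
    }
    where
    ups downs : V1 → List E′
    ups d₁ = inj₁ (e₃ , e₃≢e) ∷ []
    ups k₁ = inj₁ (e₁ , e₁≢e) ∷ inj₂ δ₁ ∷ []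
    ups k₂ = inj₁ (e₂ , e₂≢e) ∷ inj₂ δ₂ ∷ []
    downs d₁ = inj₂ δ₁ ∷ inj₂ δ₂ ∷ []
    downs k₁ = []
    downs k₂ = []
    old-ups : ∀ {x w} p → (x , w) ∈ table → inj₁ (x , p) ∈ ups w
    old-ups p (here refl)                 = here refl
    old-ups p (there (here refl))         = here refl
    old-ups p (there (there (here refl))) = here refl

  good : Good T
  good = Replacement.result-good A c k e _ _ _ _ _ _ frame

  module _ (P : Potential S) where

    -- Both `e₃` and the new edges are negative, because `e` is positive and the two upper edges of
    -- `k` differ in sign. Bounds on positive edges are vacuous for them, and the new edges may have
    -- size 0.
    δ-bound : {C : Set} → pol S e₃ ≡ pos → C
    δ-bound p = contradiction e₃-neg (pos⇒≢neg p refl)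

    1≤size : 1 ≤ size P e
    1≤size = subst (λ κ → Bound κ S (size P) e k) k-lab (bound P e-pos e-low)

    size-mono : ∀ {x} → low S x ≡ just c → pol S x ≡ pos → size P e ≤ size P x
    size-mono p x-pos = subst (λ κ → Bound κ S (size P) _ c) c-lab (bound P x-pos p) e e-up

    potential : Potential T
    potential = Replacement.result-potential A c k e _ _ _ _ _ _ frame P (λ _ → 0) λ
      { d₁ → δ-bound ∷ []
      ; k₁ → (λ _ → ≤-trans 1≤size (size-mono e₁-low e₁-pos)) ∷ δ-bound ∷ []
      ; k₂ → (λ _ → ≤-trans 1≤size (size-mono e₂-low e₂-pos)) ∷ δ-bound ∷ [] }

    step : Σ Flow λ B → A →c B × Σ (Potential (str B)) λ Q → total B Q < total A P
    -- No kept edge gains load, so the old load serves as the ceiling, and the total drops by at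
    -- least the load of `e`, which is positive.
    step with Replacement.contract A c k e _ _ _ _ _ _ V1↔ E1↔ good P potential (load S P)
                (λ {x} x≢e → Replacement.load-old A c k e _ _ _ _ _ _ P potential {x} {x≢e} refl refl)
                (λ _ → weight-neg _ _ e₃-neg)
                (m<m+n (total A P) load-e)
      where
      load-e : 0 < load S P e
      load-e rewrite e-pos | e-up | c-lab = 1≤size
    ... | B , iso , Q , lt = B , step1 r iso , Q , lt

-- Estimates shared by rules (2) and (3).

weight-≤ : ∀ p t s → weight p t s ≤ s
weight-≤ pos nothing              s = z≤n
weight-≤ pos (just interaction)   s = ≤-refl
weight-≤ pos (just cointeraction) s = z≤n
weight-≤ pos (just weakening)     s = z≤n
weight-≤ pos (just coweakening)   s = z≤n
weight-≤ pos (just contraction)   s = ≤-refl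
weight-≤ pos (just cocontraction) s = z≤n
weight-≤ neg t                    s = z≤n

weight-cocontraction : ∀ p s → weight p (just cocontraction) s ≡ 0
weight-cocontraction pos s = refl
weight-cocontraction neg s = refl

-- The two vanishing entries will be the lower edges of the cocontraction in a redex: free before
-- the reduction, possibly counted with their full sizes after it.
module Bump (f : Fin n → ℕ) {x y : Fin n} (x≢y : x ≢ y) (fx≡0 : f x ≡ 0) (fy≡0 : f y ≡ 0) (a b : ℕ) where

  private g = updateAt f x (const a)

  bump : Fin n → ℕ
  bump = updateAt g y (const b)

  bump-minimal : ∀ z → z ≢ x → z ≢ y → bump z ≡ f z
  bump-minimal z z≢x z≢y = trans (updateAt-minimal z y g z≢y) (updateAt-minimal z x f z≢x)

  bump-fst : bump x ≡ a
  bump-fst = trans (updateAt-minimal x y g x≢y) (updateAt-updates x f)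

  bump-snd : bump y ≡ b
  bump-snd = updateAt-updates y g

  sum-bump : sum bump ≡ sum f + (a + b)
  sum-bump = begin
    sum bump         ≡⟨ +-identityʳ _ ⟨
    sum bump + 0     ≡⟨ cong (sum bump +_) (trans (updateAt-minimal y x f (≢-sym x≢y)) fy≡0) ⟨
    sum bump + g y   ≡⟨ sum-updateAt y b g ⟩
    sum g + b        ≡⟨ cong (_+ b) (+-identityʳ _) ⟨
    (sum g + 0) + b  ≡⟨ cong (λ u → (sum g + u) + b) fx≡0 ⟨
    (sum g + f x) + b ≡⟨ cong (_+ b) (sum-updateAt x a f) ⟩
    (sum f + a) + b  ≡⟨ +-assoc (sum f) a b ⟩
    sum f + (a + b)  ∎
    where open ≡-Reasoning

-- Rule (2): interaction above cocontraction.

V2↔ : V2 ↔ Fin 3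
V2↔ = mk↔ₛ′ (λ { c₀ → zero ; i₁ → suc zero ; i₂ → suc (suc zero) })
            (λ { zero → c₀ ; (suc zero) → i₁ ; (suc (suc zero)) → i₂ })
            (λ { zero → refl ; (suc zero) → refl ; (suc (suc zero)) → refl })
            (λ { c₀ → refl ; i₁ → refl ; i₂ → refl })

E2↔ : E2 ↔ Fin 2
E2↔ = mk↔ₛ′ (λ { δ₁ → zero ; δ₂ → suc zero }) (λ { zero → δ₁ ; (suc zero) → δ₂ })
            (λ { zero → refl ; (suc zero) → refl }) (λ { δ₁ → refl ; δ₂ → refl })

module Rule2 (A : Flow) (r : Redex2 A) (e-pos : pol (str A) (Redex2.e r) ≡ pos) where

  open Redex2 r

  private
    S = str A
    G = flow-good A
    T = rule2 A r
    E′ = Σ (Fin (nE A)) (_≢ e) ⊎ E2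

  i≢d : i ≢ d
  i≢d refl with () ← trans (sym i-lab) d-lab

  e₁≢e : e₁ ≢ e
  e₁≢e = ends-≢ {f = up S} (≢-sym i≢d) e₁-up e-up

  e₂≢e : e₂ ≢ e
  e₂≢e = ends-≢ {f = up S} (≢-sym i≢d) e₂-up e-up

  e₁-pos : pol S e₁ ≡ pos
  e₁-pos = trans (pol-cocontraction A d d-lab e₁ e (inj₁ e₁-up) (inj₂ e-low)) e-pos

  e₂-pos : pol S e₂ ≡ pos
  e₂-pos = trans (pol-cocontraction A d d-lab e₂ e (inj₁ e₂-up) (inj₂ e-low)) e-pos

  e₃-neg : pol S e₃ ≡ neg
  e₃-neg = ≢pos⇒neg λ eq →
    pol-interaction A i i-lab e₃ e (inj₁ e₃-up) (inj₁ e-up) e₃≢e (trans eq (sym e-pos))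

  table : List (Fin (nE A) × V2)
  table = (e₃ , c₀) ∷ (e₁ , i₁) ∷ (e₂ , i₂) ∷ []

  table-unique : Unique (map proj₁ table)
  table-unique = (ends-≢ {f = up S} i≢d e₃-up e₁-up ∷ ends-≢ {f = up S} i≢d e₃-up e₂-up ∷ [])
               ∷ (e₁≢e₂ ∷ []) ∷ [] ∷ []

  frame : FrameOf A i d e T refl
  frame = record
    { e-up           = e-up
    ; e-low          = e-low
    ; rU-fix         = λ {x} p v≢i v≢d → assoc-nothing table x λ
        { w (here refl)                 → just-≢ v≢i p e₃-up
        ; w (there (here refl))         → just-≢ v≢d p e₁-up
        ; w (there (there (here refl))) → just-≢ v≢d p e₂-up }
    ; rL-fix         = λ _ _ _ → refl
    ; ups            = ups
    ; downs          = downs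
    ; ups-unique     = λ { c₀ → ((λ ()) ∷ []) ∷ [] ∷ [] ; i₁ → [] ; i₂ → [] }
    ; downs-unique   = λ { c₀ → [] ∷ [] ; i₁ → ((λ ()) ∷ []) ∷ [] ∷ [] ; i₂ → ((λ ()) ∷ []) ∷ [] ∷ [] }
    ; ups-complete   = λ { (inj₂ δ₁) refl → here refl ; (inj₂ δ₂) refl → there (here refl) }
    ; downs-complete = λ
        { (inj₁ (x , p)) eq   → old-downs p (assoc-∈ table x eq)
        ; (inj₂ δ₁)      refl → there (here refl)
        ; (inj₂ δ₂)      refl → there (here refl) }
    ; ups-sound      = λ { c₀ → refl ∷ refl ∷ [] ; i₁ → [] ; i₂ → [] }
    ; downs-sound    = λ
        { c₀ → assoc-unique table-unique (here refl) ∷ []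
        ; i₁ → assoc-unique table-unique (there (here refl)) ∷ refl ∷ []
        ; i₂ → assoc-unique table-unique (there (there (here refl))) ∷ refl ∷ [] }
    ; ups-arity      = λ { c₀ → refl ; i₁ → refl ; i₂ → refl }
    ; downs-arity    = λ { c₀ → refl ; i₁ → refl ; i₂ → refl }
    ; signs          = λ
        { c₀ → (refl ∷ refl ∷ []) ∷ (refl ∷ []) ∷ [] ∷ []
        ; i₁ → (pos⇒≢neg e₁-pos e₃-neg ∷ []) ∷ [] ∷ []
        ; i₂ → (pos⇒≢neg e₂-pos e₃-neg ∷ []) ∷ [] ∷ [] }
    -- One more than the raised rank of `e₃`, the edge below the new contraction. There is no
    -- constraint from above, as the new edges start at interactions.
    ; new-rank       = λ _ → suc (suc (rank G e₃))
    ; new-falls      = λ { c₀ → (≤-refl ∷ []) ∷ (≤-refl ∷ []) ∷ [] ; i₁ → [] ; i₂ → [] }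
    }
    where
    ups downs : V2 → List E′
    ups c₀ = inj₂ δ₁ ∷ inj₂ δ₂ ∷ []
    ups i₁ = []
    ups i₂ = []
    downs c₀ = inj₁ (e₃ , e₃≢e) ∷ []
    downs i₁ = inj₁ (e₁ , e₁≢e) ∷ inj₂ δ₁ ∷ []
    downs i₂ = inj₁ (e₂ , e₂≢e) ∷ inj₂ δ₂ ∷ []
    old-downs : ∀ {x w} p → (x , w) ∈ table → inj₁ (x , p) ∈ downs w
    old-downs p (here refl)                 = here refl
    old-downs p (there (here refl))         = here refl
    old-downs p (there (there (here refl))) = here refl

  good : Good T
  good = Replacement.result-good A i d e _ _ _ _ _ _ frame

  module _ (P : Potential S) where

    δ-bound : {C : Set} → pol S e₃ ≡ pos → C
    δ-bound p = contradiction e₃-neg (pos⇒≢neg p refl)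

    size-split : size P e₁ + size P e₂ < size P e
    size-split = subst (λ κ → Bound κ S (size P) e d) d-lab (bound P e-pos e-low) e₁ e₂ e₁≢e₂ e₁-up e₂-up

    potential : Potential T
    -- Here too the new edges share the negative polarity of `e₃`, so size 0 is harmless.
    potential = Replacement.result-potential A i d e _ _ _ _ _ _ frame P (λ _ → 0) λ
      { c₀ → δ-bound ∷ δ-bound ∷ []
      ; i₁ → []
      ; i₂ → [] }

    load-below-d : ∀ {x} → up S x ≡ just d → load S P x ≡ 0
    load-below-d {x} eq rewrite eq | d-lab = weight-cocontraction (pol S x) _

    open Bump (load S P) e₁≢e₂ (load-below-d e₁-up) (load-below-d e₂-up) (size P e₁) (size P e₂)

    load-e : load S P e ≡ size P e
    load-e rewrite e-pos | e-up | i-lab = refl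

    -- Only `e₁` and `e₂`, which now leave interactions, can gain load. The edge `e₃` now leaves a
    -- contraction, but it is negative and has load 0.
    old≤ : ∀ {x} p → load T potential (inj₁ (x , p)) ≤ bump x
    old≤ {x} p = by-table (assoc table x) refl
      where
      absent : ∀ {y w} → assoc table x ≡ nothing → (y , w) ∈ table → x ≢ y
      absent eq y∈ refl with () ← trans (sym eq) (assoc-unique table-unique y∈)
      by-table : ∀ m → assoc table x ≡ m → load T potential (inj₁ (x , p)) ≤ bump x
      by-table nothing  eq = ≤-trans
        (Replacement.load-old A i d e _ _ _ _ _ _ P potential {x} {p} refl eq)
        (≤-reflexive (sym (bump-minimal x (absent eq (there (here refl))) (absent eq (there (there (here refl)))))))
      by-table (just w) eq with assoc-∈ table x eq
      ... | here refl                 = ≤-trans (≤-reflexive (weight-neg _ _ e₃-neg)) z≤n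
      ... | there (here refl)         = ≤-trans (weight-≤ (pol S x) _ _) (≤-reflexive (sym bump-fst))
      ... | there (there (here refl)) = ≤-trans (weight-≤ (pol S x) _ _) (≤-reflexive (sym bump-snd))

    -- The gain of `e₁` and `e₂` is smaller than the load of `e`, by the strict bound at the
    -- cocontraction `d`.
    sum-lt : sum bump < total A P + bump e
    sum-lt = begin-strict
      sum bump                              ≡⟨ sum-bump ⟩
      total A P + (size P e₁ + size P e₂)   <⟨ +-monoʳ-< (total A P) size-split ⟩
      total A P + size P e                  ≡⟨ cong (total A P +_) bump-e ⟨
      total A P + bump e                    ∎
      where
      open ≤-Reasoning
      bump-e : bump e ≡ size P e
      bump-e = trans (bump-minimal e (≢-sym e₁≢e) (≢-sym e₂≢e)) load-e

    step : Σ Flow λ B → A →c B × Σ (Potential (str B)) λ Q → total B Q < total A P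
    step with Replacement.contract A i d e _ _ _ _ _ _ V2↔ E2↔ good P potential bump old≤ 
                (λ _ → weight-neg _ _ e₃-neg) sum-lt
    ... | B , iso , Q , lt = B , step2 r iso , Q , lt

-- Rule (3): contraction above cocontraction.

V3↔ : V3 ↔ Fin 4
V3↔ = mk↔ₛ′ (λ { d₁ → zero ; d₂ → suc zero ; c₃ → suc (suc zero) ; c₄ → suc (suc (suc zero)) })
            (λ { zero → d₁ ; (suc zero) → d₂ ; (suc (suc zero)) → c₃ ; (suc (suc (suc zero))) → c₄ })
            (λ { zero → refl ; (suc zero) → refl ; (suc (suc zero)) → refl ; (suc (suc (suc zero))) → refl })
            (λ { d₁ → refl ; d₂ → refl ; c₃ → refl ; c₄ → refl })

E3↔ : E3 ↔ Fin 4
E3↔ = mk↔ₛ′ (λ { δ₁₃ → zero ; δ₁₄ → suc zero ; δ₂₃ → suc (suc zero) ; δ₂₄ → suc (suc (suc zero)) })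
            (λ { zero → δ₁₃ ; (suc zero) → δ₁₄ ; (suc (suc zero)) → δ₂₃ ; (suc (suc (suc zero))) → δ₂₄ })
            (λ { zero → refl ; (suc zero) → refl ; (suc (suc zero)) → refl ; (suc (suc (suc zero))) → refl })
            (λ { δ₁₃ → refl ; δ₁₄ → refl ; δ₂₃ → refl ; δ₂₄ → refl })

module Rule3 (A : Flow) (r : Redex3 A) (e-pos : pol (str A) (Redex3.e r) ≡ pos) where

  open Redex3 r

  private
    S = str A
    G = flow-good A
    T = rule3 A r
    E′ = Σ (Fin (nE A)) (_≢ e) ⊎ E3

  c≢d : c ≢ d
  c≢d refl with () ← trans (sym c-lab) d-lab

  e₁≢e : e₁ ≢ e
  e₁≢e = ends-≢ {f = low S} c≢d e₁-low e-low

  e₂≢e : e₂ ≢ e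
  e₂≢e = ends-≢ {f = low S} c≢d e₂-low e-low

  e₃≢e : e₃ ≢ e
  e₃≢e = ends-≢ {f = up S} (≢-sym c≢d) e₃-up e-up

  e₄≢e : e₄ ≢ e
  e₄≢e = ends-≢ {f = up S} (≢-sym c≢d) e₄-up e-up

  above-pol : ∀ {x} → low S x ≡ just c → pol S x ≡ pol S e
  above-pol p = pol-contraction A c c-lab _ e (inj₂ p) (inj₁ e-up)

  below-pol : ∀ {x} → up S x ≡ just d → pol S e ≡ pol S x
  below-pol p = pol-cocontraction A d d-lab e _ (inj₂ e-low) (inj₁ p)

  upTable lowTable : List (Fin (nE A) × V3)
  upTable  = (e₃ , c₃) ∷ (e₄ , c₄) ∷ []
  lowTable = (e₁ , d₁) ∷ (e₂ , d₂) ∷ []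

  upTable-unique : Unique (map proj₁ upTable)
  upTable-unique = (e₃≢e₄ ∷ []) ∷ [] ∷ []

  lowTable-unique : Unique (map proj₁ lowTable)
  lowTable-unique = (e₁≢e₂ ∷ []) ∷ [] ∷ []

  ups downs : V3 → List E′
  ups d₁ = inj₁ (e₁ , e₁≢e) ∷ []
  ups d₂ = inj₁ (e₂ , e₂≢e) ∷ []
  ups c₃ = inj₂ δ₁₃ ∷ inj₂ δ₂₃ ∷ []
  ups c₄ = inj₂ δ₁₄ ∷ inj₂ δ₂₄ ∷ []
  downs d₁ = inj₂ δ₁₃ ∷ inj₂ δ₁₄ ∷ []
  downs d₂ = inj₂ δ₂₃ ∷ inj₂ δ₂₄ ∷ []
  downs c₃ = inj₁ (e₃ , e₃≢e) ∷ []
  downs c₄ = inj₁ (e₄ , e₄≢e) ∷ []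

  frame : FrameOf A c d e T refl
  frame = record
    { e-up           = e-up
    ; e-low          = e-low
    ; rU-fix         = λ {x} p v≢c v≢d → assoc-nothing upTable x λ
        { w (here refl)         → just-≢ v≢d p e₃-up
        ; w (there (here refl)) → just-≢ v≢d p e₄-up }
    ; rL-fix         = λ {x} p v≢c v≢d → assoc-nothing lowTable x λ
        { w (here refl)         → just-≢ v≢c p e₁-low
        ; w (there (here refl)) → just-≢ v≢c p e₂-low }
    ; ups            = ups
    ; downs          = downs
    ; ups-unique     = λ
        { d₁ → [] ∷ [] ; d₂ → [] ∷ [] ; c₃ → ((λ ()) ∷ []) ∷ [] ∷ [] ; c₄ → ((λ ()) ∷ []) ∷ [] ∷ [] }
    ; downs-unique   = λ
        { d₁ → ((λ ()) ∷ []) ∷ [] ∷ [] ; d₂ → ((λ ()) ∷ []) ∷ [] ∷ [] ; c₃ → [] ∷ [] ; c₄ → [] ∷ [] }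
    ; ups-complete   = λ
        { (inj₁ (x , p)) eq   → old-ups p (assoc-∈ lowTable x eq)
        ; (inj₂ δ₁₃)     refl → here refl
        ; (inj₂ δ₁₄)     refl → here refl
        ; (inj₂ δ₂₃)     refl → there (here refl)
        ; (inj₂ δ₂₄)     refl → there (here refl) }
    ; downs-complete = λ
        { (inj₁ (x , p)) eq   → old-downs p (assoc-∈ upTable x eq)
        ; (inj₂ δ₁₃)     refl → here refl
        ; (inj₂ δ₁₄)     refl → there (here refl)
        ; (inj₂ δ₂₃)     refl → here refl
        ; (inj₂ δ₂₄)     refl → there (here refl) }
    ; ups-sound      = λ
        { d₁ → assoc-unique lowTable-unique (here refl) ∷ []
        ; d₂ → assoc-unique lowTable-unique (there (here refl)) ∷ []
        ; c₃ → refl ∷ refl ∷ []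
        ; c₄ → refl ∷ refl ∷ [] }
    ; downs-sound    = λ
        { d₁ → refl ∷ refl ∷ []
        ; d₂ → refl ∷ refl ∷ []
        ; c₃ → assoc-unique upTable-unique (here refl) ∷ []
        ; c₄ → assoc-unique upTable-unique (there (here refl)) ∷ [] }
    ; ups-arity      = λ { d₁ → refl ; d₂ → refl ; c₃ → refl ; c₄ → refl }
    ; downs-arity    = λ { d₁ → refl ; d₂ → refl ; c₃ → refl ; c₄ → refl }
    ; signs          = λ
        { d₁ → (above-pol e₁-low ∷ above-pol e₁-low ∷ []) ∷ (refl ∷ []) ∷ [] ∷ []
        ; d₂ → (above-pol e₂-low ∷ above-pol e₂-low ∷ []) ∷ (refl ∷ []) ∷ [] ∷ []
        ; c₃ → (refl ∷ below-pol e₃-up ∷ []) ∷ (below-pol e₃-up ∷ []) ∷ [] ∷ []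
        ; c₄ → (refl ∷ below-pol e₄-up ∷ []) ∷ (below-pol e₄-up ∷ []) ∷ [] ∷ [] }
    -- The new edges take the place of `e`, so its raised rank fits between those of `e₁`, `e₂`
    -- above and `e₃`, `e₄` below.
    ; new-rank       = λ _ → suc (rank G e)
    ; new-falls      = λ
        { d₁ → (s≤s (falls G e₁-low e-up) ∷ s≤s (falls G e₁-low e-up) ∷ []) ∷ []
        ; d₂ → (s≤s (falls G e₂-low e-up) ∷ s≤s (falls G e₂-low e-up) ∷ []) ∷ []
        ; c₃ → (s≤s (falls G e-low e₃-up) ∷ []) ∷ (s≤s (falls G e-low e₃-up) ∷ []) ∷ []
        ; c₄ → (s≤s (falls G e-low e₄-up) ∷ []) ∷ (s≤s (falls G e-low e₄-up) ∷ []) ∷ [] }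
    }
    where
    old-ups : ∀ {x w} p → (x , w) ∈ lowTable → inj₁ (x , p) ∈ ups w
    old-ups p (here refl)         = here refl
    old-ups p (there (here refl)) = here refl
    old-downs : ∀ {x w} p → (x , w) ∈ upTable → inj₁ (x , p) ∈ downs w
    old-downs p (here refl)         = here refl
    old-downs p (there (here refl)) = here refl

  good : Good T
  good = Replacement.result-good A c d e _ _ _ _ _ _ frame

  module _ (P : Potential S) where

    size-split : size P e₃ + size P e₄ < size P e
    size-split = subst (λ κ → Bound κ S (size P) e d) d-lab (bound P e-pos e-low) e₃ e₄ e₃≢e₄ e₃-up e₄-up

    size-above : ∀ {x} → low S x ≡ just c → size P e ≤ size P x
    size-above p = subst (λ κ → Bound κ S (size P) _ c) c-lab (bound P (trans (above-pol p) e-pos) p) e e-up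

    -- Each new edge copies the size of the edge below the contraction it enters, which settles the
    -- new contractions. The two edges leaving a new cocontraction then sum to less than the size of
    -- `e`, hence to less than the size of `e₁` and of `e₂`.
    new-size : E3 → ℕ
    new-size δ₁₃ = size P e₃
    new-size δ₁₄ = size P e₄
    new-size δ₂₃ = size P e₃
    new-size δ₂₄ = size P e₄

    potential : Potential T
    potential = Replacement.result-potential A c d e _ _ _ _ _ _ frame P new-size λ
      { d₁ → (λ _ y z y≢z p q → split-d₁ y≢z (below y p) (below z q)) ∷ []
      ; d₂ → (λ _ y z y≢z p q → split-d₂ y≢z (below y p) (below z q)) ∷ []
      ; c₃ → (λ _ y p → merge-c₃ (below y p)) ∷ (λ _ y p → merge-c₃ (below y p)) ∷ []
      ; c₄ → (λ _ y p → merge-c₄ (below y p)) ∷ (λ _ y p → merge-c₄ (below y p)) ∷ [] }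
      where
      s = Replacement.extend A c d e _ _ _ _ _ _ (size P) new-size
      below : ∀ {w} y → up T y ≡ just (inj₂ w) → y ∈ downs w
      below y eq = Replacement.Frame.downs-complete frame y (Replacement.at-up⁻ A c d e _ _ _ _ _ _ y eq)
      split : ∀ {x} → low S x ≡ just c → size P e₃ + size P e₄ < size P x
      split p = <-≤-trans size-split (size-above p)
      split-swap : ∀ {x} → low S x ≡ just c → size P e₄ + size P e₃ < size P x
      split-swap {x} p = subst (_< size P x) (+-comm (size P e₃) _) (split p)
      split-d₁ : ∀ {y z} → y ≢ z → y ∈ downs d₁ → z ∈ downs d₁ → s y + s z < size P e₁
      split-d₁ y≢z (here refl)         (here refl)         = contradiction refl y≢z
      split-d₁ y≢z (here refl)         (there (here refl)) = split e₁-low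
      split-d₁ y≢z (there (here refl)) (here refl)         = split-swap e₁-low
      split-d₁ y≢z (there (here refl)) (there (here refl)) = contradiction refl y≢z
      split-d₂ : ∀ {y z} → y ≢ z → y ∈ downs d₂ → z ∈ downs d₂ → s y + s z < size P e₂
      split-d₂ y≢z (here refl)         (here refl)         = contradiction refl y≢z
      split-d₂ y≢z (here refl)         (there (here refl)) = split e₂-low
      split-d₂ y≢z (there (here refl)) (here refl)         = split-swap e₂-low
      split-d₂ y≢z (there (here refl)) (there (here refl)) = contradiction refl y≢z
      merge-c₃ : ∀ {y} → y ∈ downs c₃ → s y ≤ size P e₃
      merge-c₃ (here refl) = ≤-refl
      merge-c₄ : ∀ {y} → y ∈ downs c₄ → s y ≤ size P e₄
      merge-c₄ (here refl) = ≤-refl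

    load-below-d : ∀ {x} → up S x ≡ just d → load S P x ≡ 0
    load-below-d {x} eq rewrite eq | d-lab = weight-cocontraction (pol S x) _

    open Bump (load S P) e₃≢e₄ (load-below-d e₃-up) (load-below-d e₄-up) (size P e₃) (size P e₄)

    load-e : load S P e ≡ size P e
    load-e rewrite e-pos | e-up | c-lab = refl

    old≤ : ∀ {x} p → load T potential (inj₁ (x , p)) ≤ bump x
    old≤ {x} p = by-table (assoc upTable x) refl
      where
      absent : ∀ {y w} → assoc upTable x ≡ nothing → (y , w) ∈ upTable → x ≢ y
      absent eq y∈ refl with () ← trans (sym eq) (assoc-unique upTable-unique y∈)
      by-table : ∀ m → assoc upTable x ≡ m → load T potential (inj₁ (x , p)) ≤ bump x
      by-table nothing  eq = ≤-trans
        (Replacement.load-old A c d e _ _ _ _ _ _ P potential {x} {p} refl eq)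
        (≤-reflexive (sym (bump-minimal x (absent eq (here refl)) (absent eq (there (here refl))))))
      by-table (just w) eq with assoc-∈ upTable x eq
      ... | here refl         = ≤-trans (weight-≤ (pol S x) _ _) (≤-reflexive (sym bump-fst))
      ... | there (here refl) = ≤-trans (weight-≤ (pol S x) _ _) (≤-reflexive (sym bump-snd))

    -- The new edges do have positive polarity, but they leave cocontractions, where nothing is
    -- counted.
    new≡0 : ∀ δ → load T potential (inj₂ δ) ≡ 0
    new≡0 δ₁₃ = weight-cocontraction (pol S e) _
    new≡0 δ₁₄ = weight-cocontraction (pol S e) _
    new≡0 δ₂₃ = weight-cocontraction (pol S e) _
    new≡0 δ₂₄ = weight-cocontraction (pol S e) _

    sum-lt : sum bump < total A P + bump e
    sum-lt = begin-strict
      sum bump                              ≡⟨ sum-bump ⟩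
      total A P + (size P e₃ + size P e₄)   <⟨ +-monoʳ-< (total A P) size-split ⟩
      total A P + size P e                  ≡⟨ cong (total A P +_) bump-e ⟨
      total A P + bump e                    ∎
      where
      open ≤-Reasoning
      bump-e : bump e ≡ size P e
      bump-e = trans (bump-minimal e (≢-sym e₃≢e) (≢-sym e₄≢e)) load-e

    step : Σ Flow λ B → A →c B × Σ (Potential (str B)) λ Q → total B Q < total A P
    step with Replacement.contract A c d e _ _ _ _ _ _ V3↔ E3↔ good P potential bump old≤ new≡0 sum-lt
    ... | B , iso , Q , lt = B , step3 r iso , Q , lt

-- Initial potential and termination.

3^-split : ∀ {a b r} → a < r → b < r → 3 ^ a + 3 ^ b < 3 ^ r
3^-split {a} {b} {suc r} (s≤s a≤r) (s≤s b≤r) = begin-strict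
  3 ^ a + 3 ^ b             ≤⟨ +-mono-≤ (^-monoʳ-≤ 3 a≤r) (^-monoʳ-≤ 3 b≤r) ⟩
  3 ^ r + 3 ^ r             <⟨ +-monoʳ-< (3 ^ r) (m<m+n (3 ^ r) (m≤n⇒m≤n+o 0 (m^n>0 3 r))) ⟩
  3 ^ r + (3 ^ r + (3 ^ r + 0)) ∎
  where open ≤-Reasoning

-- Powers of 3 suffice: two powers with smaller exponents sum to at most two thirds of the larger
-- one, which gives the strict bound at cocontractions. Powers of 2 could give equality.
initial-potential : {V E : Set} {S : Str V E} → Good S → Potential S
size (initial-potential G) x = 3 ^ rank G x
bound (initial-potential {S = S} G) {x} {v} _ p with lab S v
... | cointeraction = m^n>0 3 (rank G x)
... | contraction   = λ y q → ^-monoʳ-≤ 3 (<⇒≤ (falls G p q))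
... | cocontraction = λ y z _ q r → 3^-split {rank G y} {rank G z} (falls G p q) (falls G p r)
... | interaction   = tt
... | weakening     = tt
... | coweakening   = tt

-- These are the positive central edges of the redexes of rules (1), (2) and (3). Indexing by the
-- kinds of the two ends, rather than by vertices, makes the property decidable by cases.
data Active : Polarity → Maybe Kind → Maybe Kind → Set where
  active₁ : Active pos (just contraction) (just cointeraction)
  active₂ : Active pos (just interaction) (just cocontraction)
  active₃ : Active pos (just contraction) (just cocontraction)

active? : ∀ p t b → Dec (Active p t b)
active? pos (just contraction)   (just cointeraction) = yes active₁
active? pos (just contraction)   (just cocontraction) = yes active₃
active? pos (just contraction)   (just interaction)   = no λ ()
active? pos (just contraction)   (just weakening)     = no λ ()
active? pos (just contraction)   (just coweakening)   = no λ ()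
active? pos (just contraction)   (just contraction)   = no λ ()
active? pos (just contraction)   nothing              = no λ ()
active? pos (just interaction)   (just cocontraction) = yes active₂
active? pos (just interaction)   (just cointeraction) = no λ ()
active? pos (just interaction)   (just interaction)   = no λ ()
active? pos (just interaction)   (just weakening)     = no λ ()
active? pos (just interaction)   (just coweakening)   = no λ ()
active? pos (just interaction)   (just contraction)   = no λ ()
active? pos (just interaction)   nothing              = no λ ()
active? pos (just cointeraction) b                    = no λ ()
active? pos (just weakening)     b                    = no λ ()
active? pos (just coweakening)   b                    = no λ ()
active? pos (just cocontraction) b                    = no λ ()
active? pos nothing              b                    = no λ ()
active? neg t                    b                    = no λ ()

ActiveEdge : (A : Flow) → Fin (nE A) → Set
ActiveEdge A x = Active (pol S x) (topKind S x) (Maybe.map (lab S) (low S x))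
  where S = str A

map-just⁻ : {f : A → B} {m : Maybe A} {y : B} → Maybe.map f m ≡ just y → ∃ λ x → m ≡ just x × f x ≡ y
map-just⁻ {m = just x} refl = x , refl , refl

module _ (A : Flow) where

  private
    S = str A
    G = flow-good A

  uppersOf : ∀ {v κ} → lab S v ≡ κ → Card (λ x → low S x ≡ just v) (upperArity κ)
  uppersOf eq = subst (Card _ ∘ upperArity) eq (uppers G _)

  lowersOf : ∀ {v κ} → lab S v ≡ κ → Card (λ x → up S x ≡ just v) (lowerArity κ)
  lowersOf eq = subst (Card _ ∘ lowerArity) eq (lowers G _)

  -- The arities of the two end vertices supply the remaining edges of the redex.
  reduce : ∀ {x} → ActiveEdge A x → (P : Potential S) →
           Σ Flow λ B → A →c B × Σ (Potential (str B)) λ Q → total B Q < total A P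
  reduce {x} a P with pol S x in p | topKind S x in t | Maybe.map (lab S) (low S x) in b | a
  ... | _ | _ | _ | active₁ with map-just⁻ t | map-just⁻ b
  ... | c , e-up , c-lab | k , e-low , k-lab
      with card2-pair (uppersOf c-lab) | card2-other (uppersOf k-lab) e-low
  ... | e₁ , e₂ , e₁-low , e₂-low , e₁≢e₂ | e₃ , e₃-low , e₃≢e = Rule1.step A (record
    { c-lab = c-lab ; k-lab = k-lab ; e₁-low = e₁-low ; e₂-low = e₂-low ; e₁≢e₂ = e₁≢e₂
    ; e-up = e-up ; e-low = e-low ; e₃-low = e₃-low ; e₃≢e = e₃≢e }) p P
  reduce {x} a P | _ | _ | _ | active₂ with map-just⁻ t | map-just⁻ b
  ... | i , e-up , i-lab | d , e-low , d-lab
      with card2-pair (lowersOf d-lab) | card2-other (lowersOf i-lab) e-up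
  ... | e₁ , e₂ , e₁-up , e₂-up , e₁≢e₂ | e₃ , e₃-up , e₃≢e = Rule2.step A (record
    { i-lab = i-lab ; d-lab = d-lab ; e-up = e-up ; e-low = e-low ; e₃-up = e₃-up ; e₃≢e = e₃≢e
    ; e₁-up = e₁-up ; e₂-up = e₂-up ; e₁≢e₂ = e₁≢e₂ }) p P
  reduce {x} a P | _ | _ | _ | active₃ with map-just⁻ t | map-just⁻ b
  ... | c , e-up , c-lab | d , e-low , d-lab
      with card2-pair (uppersOf c-lab) | card2-pair (lowersOf d-lab)
  ... | e₁ , e₂ , e₁-low , e₂-low , e₁≢e₂ | e₃ , e₄ , e₃-up , e₄-up , e₃≢e₄ = Rule3.step A (record
    { c-lab = c-lab ; d-lab = d-lab ; e₁-low = e₁-low ; e₂-low = e₂-low ; e₁≢e₂ = e₁≢e₂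
    ; e-up = e-up ; e-low = e-low ; e₃-up = e₃-up ; e₄-up = e₄-up ; e₃≢e₄ = e₃≢e₄ }) p P

Normal : Flow → Set
Normal A = ∀ x → ¬ ActiveEdge A x

-- Each reduction lowers the total by at least one, so the strict bound `n` on the total also limits
-- the number of reductions.
normalise : ∀ n (A : Flow) (P : Potential (str A)) → total A P < n → Σ Flow λ B → A →c⋆ B × Normal B
normalise (suc n) A P (s≤s total≤n)
  with any? (λ x → active? (pol (str A) x) (topKind (str A) x) (Maybe.map (lab (str A)) (low (str A) x)))
... | no ¬active = A , ε , λ x a → ¬active (x , a)
... | yes (x , a) with reduce A a P
... | B , A→B , Q , lt with normalise n B Q (<-≤-trans lt total≤n)
... | C , B→C , normal = C , A→B ◅ B→C , normal

-- Charge along ai-paths and cycles in normal flows.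

flipPol : Polarity → Polarity
flipPol pos = neg
flipPol neg = pos

flipPol-≢ : ∀ {p q} → p ≢ q → flipPol p ≡ q
flipPol-≢ {pos} {pos} p≢q = contradiction refl p≢q
flipPol-≢ {pos} {neg} p≢q = refl
flipPol-≢ {neg} {pos} p≢q = refl
flipPol-≢ {neg} {neg} p≢q = contradiction refl p≢q

flipPol-pos⁻ : ∀ {p} → flipPol p ≡ pos → p ≡ neg
flipPol-pos⁻ {neg} refl = refl

module Cycles (A : Flow) where

  private
    S = str A
    G = flow-good A

  charge : Step A → Polarity
  charge (x , ↓) = pol S x
  charge (x , ↑) = flipPol (pol S x)

  -- A turn is constrained by charge alone. This determines the kind of vertex at which it happens,
  -- excludes turning back along the same edge, and is preserved by reversal.
  Link : Step A → Step A → Set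
  Link a b = ∃ λ ν → tgt A a ≡ just ν × src A b ≡ just ν × charge a ≡ charge b

  -- Contractions and cocontractions are the only vertices with edges on both sides.
  through : ∀ {x y ν} → low S x ≡ just ν → up S y ≡ just ν →
            (lab S ν ≡ contraction ⊎ lab S ν ≡ cocontraction) × pol S x ≡ pol S y
  through {x} {y} {ν} p q with lab S ν in eq
  ... | interaction   = contradiction p (card0-empty (uppersOf A eq))
  ... | cointeraction = contradiction q (card0-empty (lowersOf A eq))
  ... | weakening     = contradiction p (card0-empty (uppersOf A eq))
  ... | coweakening   = contradiction q (card0-empty (lowersOf A eq))
  ... | contraction   = inj₁ refl , pol-contraction A ν eq x y (inj₂ p) (inj₁ q)
  ... | cocontraction = inj₂ refl , pol-cocontraction A ν eq x y (inj₂ p) (inj₁ q)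

  -- A coweakening has only one upper edge, and (co)contractions force equal polarities, so no other
  -- kind allows two upper edges of different sign.
  turn-down : ∀ {x y ν} → low S x ≡ just ν → low S y ≡ just ν → pol S x ≢ pol S y → lab S ν ≡ cointeraction
  turn-down {x} {y} {ν} p q d with lab S ν in eq
  ... | interaction   = contradiction p (card0-empty (uppersOf A eq))
  ... | cointeraction = refl
  ... | weakening     = contradiction p (card0-empty (uppersOf A eq))
  ... | coweakening   = contradiction (cong (pol S) (card1-unique (uppersOf A eq) p q)) d
  ... | contraction   = contradiction (pol-contraction A ν eq x y (inj₂ p) (inj₂ q)) d
  ... | cocontraction = contradiction (pol-cocontraction A ν eq x y (inj₂ p) (inj₂ q)) d

  turn-up : ∀ {x y ν} → up S x ≡ just ν → up S y ≡ just ν → pol S x ≢ pol S y → lab S ν ≡ interaction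
  turn-up {x} {y} {ν} p q d with lab S ν in eq
  ... | interaction   = refl
  ... | cointeraction = contradiction p (card0-empty (lowersOf A eq))
  ... | weakening     = contradiction (cong (pol S) (card1-unique (lowersOf A eq) p q)) d
  ... | coweakening   = contradiction p (card0-empty (lowersOf A eq))
  ... | contraction   = contradiction (pol-contraction A ν eq x y (inj₁ p) (inj₁ q)) d
  ... | cocontraction = contradiction (pol-cocontraction A ν eq x y (inj₁ p) (inj₁ q)) d

  -- At an interaction the path arrives upwards and leaves downwards, at a cointeraction the other
  -- way round. The change of direction compensates the change of polarity.
  ai-charge : ∀ a b {ν} → tgt A a ≡ just ν → src A b ≡ just ν → IsAiVertex A ν → proj₁ a ≢ proj₁ b →
              charge a ≡ charge b
  ai-charge (x , ↑) (y , ↓) p q (inj₁ eq) x≢y = flipPol-≢ (pol-interaction A _ eq x y (inj₁ p) (inj₁ q) x≢y)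
  ai-charge (x , ↓) (y , ↑) p q (inj₂ eq) x≢y =
    sym (flipPol-≢ (≢-sym (pol-cointeraction A _ eq x y (inj₂ p) (inj₂ q) x≢y)))
  ai-charge (x , ↓) _       p q (inj₁ eq) x≢y = contradiction p (card0-empty (uppersOf A eq))
  ai-charge (x , ↑) (y , ↑) p q (inj₁ eq) x≢y = contradiction q (card0-empty (uppersOf A eq))
  ai-charge (x , ↑) _       p q (inj₂ eq) x≢y = contradiction p (card0-empty (lowersOf A eq))
  ai-charge (x , ↓) (y , ↓) p q (inj₂ eq) x≢y = contradiction q (card0-empty (lowersOf A eq))

  data Walk : Step A → Step A → List (Step A) → Set where
    stop : ∀ a → Walk a a (a ∷ [])
    _∷_  : ∀ {a b c s} → Link a b → Walk b c s → Walk a c (a ∷ s)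

  walk-++ : ∀ {a b c d s t} → Walk a b s → Link b c → Walk c d t → Walk a d (s ++ t)
  walk-++ (stop _) k v = k ∷ v
  walk-++ (l ∷ w)  k v = l ∷ walk-++ w k v

  walk-head : ∀ {a b c s} → Walk a b (c ∷ s) → a ≡ c
  walk-head (stop _) = refl
  walk-head (_ ∷ _)  = refl

  walk-last : ∀ {a b c} s → Walk a b (s ++ c ∷ []) → b ≡ c
  walk-last []           (stop _) = refl
  walk-last (_ ∷ [])     (_ ∷ w) = walk-last [] w
  walk-last (_ ∷ x ∷ s)  (_ ∷ w) = walk-last (x ∷ s) w

  walk-charge : ∀ {a b s} → Walk a b s → ∀ {x} → x ∈ s → charge a ≡ charge x
  walk-charge (stop _)              (here refl) = refl
  walk-charge (_ ∷ _)               (here refl) = refl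
  walk-charge ((_ , _ , _ , q) ∷ w) (there x∈)  = trans q (walk-charge w x∈)

  walk-∋head : ∀ {a b s} → Walk a b s → a ∈ s
  walk-∋head (stop _) = here refl
  walk-∋head (_ ∷ _)  = here refl

  walk-∋last : ∀ {a b s} → Walk a b s → b ∈ s
  walk-∋last (stop _) = here refl
  walk-∋last (_ ∷ w)  = there (walk-∋last w)

  walk-succ : ∀ {a b s} → Walk a b s → ∀ {x} → x ∈ s → x ≡ b ⊎ ∃ λ y → y ∈ s × Link x y
  walk-succ (stop _) (here refl) = inj₁ refl
  walk-succ (l ∷ w)  (here refl) = inj₂ (_ , there (walk-∋head w) , l)
  walk-succ (l ∷ w)  (there x∈)  with walk-succ w x∈
  ... | inj₁ eq           = inj₁ eq
  ... | inj₂ (y , y∈ , k) = inj₂ (y , there y∈ , k)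

  walk-pred : ∀ {a b s} → Walk a b s → ∀ {x} → x ∈ s → x ≡ a ⊎ ∃ λ y → y ∈ s × Link y x
  walk-pred (stop _) (here refl) = inj₁ refl
  walk-pred (l ∷ w)  (here refl) = inj₁ refl
  walk-pred (l ∷ w)  (there x∈)  with walk-pred w x∈
  ... | inj₁ refl         = inj₂ (_ , here refl , l)
  ... | inj₂ (y , y∈ , k) = inj₂ (y , there y∈ , k)

  down-walk : ∀ {x l} → DownPath S (x ∷ l) → ∃ λ b → Walk (x , ↓) b (map (_, ↓) (x ∷ l))
  down-walk (one x) = _ , stop _
  down-walk (cons x y l v p q d) with down-walk d
  ... | b , w = b , (v , p , q , proj₂ (through p q)) ∷ w

  up-walk : ∀ {x l} → DownPath S (x ∷ l) → ∃ λ b → Walk b (x , ↑) (reverse (map (_, ↑) (x ∷ l)))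
  up-walk (one x) = _ , stop _
  up-walk (cons x y l v p q d) with up-walk d
  ... | b , w = b , subst (Walk b (x , ↑)) (sym (List.unfold-reverse (x , ↑) (map (_, ↑) (y ∷ l))))
                      (walk-++ w (v , q , p , cong flipPol (sym (proj₂ (through p q)))) (stop _))

  -- The tree of joins is flattened into one chain of links, where neighbouring steps are directly
  -- accessible.
  ai-walk : ∀ {s} → AiPath A s → ∃₂ λ a b → Walk a b s
  ai-walk (path (inj₁ (x ∷ l , d , refl))) = _ , down-walk d
  ai-walk (path (inj₂ (x ∷ l , d , refl))) with up-walk d
  ... | a , w = a , _ , w
  ai-walk (join s t a b ν p₁ p₂ q r ai a≢b) with ai-walk p₁ | ai-walk p₂
  ... | a₀ , _ , w₁ | _ , b₀ , w₂ with walk-last s w₁ | walk-head w₂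
  ... | refl | refl = a₀ , b₀ , walk-++ w₁ (ν , q , r , ai-charge a b q r ai a≢b) w₂

  -- The argument only moves from step to step along links, so it is stated for a set closed under
  -- successors and predecessors. The steps of a closed walk form such a set, and so do their
  -- reversals.
  module Closed (normal : Normal A) (X : Step A → Set)
    (succ : ∀ {a} → X a → ∃ λ b → X b × Link a b)
    (pred : ∀ {b} → X b → ∃ λ a → X a × Link a b)
    (positive : ∀ {a} → X a → charge a ≡ pos) where

    open Descent A using (_▷_; ▷-wellFounded; ▷-noetherian)

    not-active : ∀ {x u w κ κ′} → X (x , ↓) → up S x ≡ just u → lab S u ≡ κ →
                 low S x ≡ just w → lab S w ≡ κ′ → ¬ Active pos (just κ) (just κ′)
    not-active {x} X↓ p refl q refl a = normal x
      (subst (λ c → Active c (topKind S x) (Maybe.map (lab S) (low S x))) (sym (positive X↓))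
      (subst₂ (Active pos) (sym (cong (Maybe.map (lab S)) p)) (sym (cong (Maybe.map (lab S)) q)) a))

    opposite : ∀ {x y} → X (x , ↓) → X (y , ↑) → pol S x ≢ pol S y
    opposite X↓ X↑ = pos⇒≢neg (positive X↓) (flipPol-pos⁻ (positive X↑))

    -- A turn just below would exhibit a redex of rule (1), a cocontraction one of rule (3). The
    -- only continuation enters another contraction, where the situation repeats, and downward paths
    -- are finite.
    not-below-contraction : ∀ {x ν} → Acc (flip _▷_) x → X (x , ↓) → up S x ≡ just ν → lab S ν ≢ contraction
    not-below-contraction {x} (acc rs) X↓ p eq with succ X↓
    ... | (y , ↑) , Y , μ , q , r , _ = not-active X↓ p eq q (turn-down q r (opposite X↓ Y)) active₁
    ... | (y , ↓) , Y , μ , q , r , _ with proj₁ (through q r)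
    ...   | inj₁ eq′ = not-below-contraction (rs (μ , q , r)) Y r eq′
    ...   | inj₂ eq′ = not-active X↓ p eq q eq′ active₃

    -- If the next step turns, the edge ends in a cointeraction. Otherwise it enters a contraction,
    -- excluded by the preceding lemma, or a cocontraction, giving a redex of rule (2).
    simple-below-interaction : ∀ {x ν} → X (x , ↓) → up S x ≡ just ν → lab S ν ≡ interaction → SimpleEdge A x
    simple-below-interaction {x} {ν} X↓ p eq with succ X↓
    ... | (y , ↑) , Y , μ , q , r , _ = ν , μ , p , eq , q , turn-down q r (opposite X↓ Y)
    ... | (y , ↓) , Y , μ , q , r , _ with proj₁ (through q r)
    ...   | inj₁ eq′ = contradiction eq′ (not-below-contraction (▷-noetherian y) Y r)
    ...   | inj₂ eq′ = contradiction active₂ (not-active X↓ p eq q eq′)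

    Simple∈X : Set
    Simple∈X = ∃ λ x → X (x , ↓) × SimpleEdge A x

    -- Predecessors of a downward step lead upwards until the set turns, and by polarity it turns at
    -- an interaction.
    climb : ∀ {x} → Acc _▷_ x → X (x , ↓) → Simple∈X
    climb {x} (acc rs) X↓ with pred X↓
    ... | (y , ↓) , Y , ν , p , q , _ = climb (rs (ν , p , q)) Y
    ... | (y , ↑) , Y , ν , p , q , _ = x , X↓ , simple-below-interaction X↓ q (turn-up q p (opposite X↓ Y))

    -- Predecessors of an upward step lead downwards, which must end in a turn; from there `climb`
    -- applies.
    descend : ∀ {x} → Acc (flip _▷_) x → X (x , ↑) → Simple∈X
    descend {x} (acc rs) X↑ with pred X↑
    ... | (y , ↓) , Y , _             = climb (▷-wellFounded y) Y
    ... | (y , ↑) , Y , ν , p , q , _ = descend (rs (ν , q , p)) Y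

    simple : ∀ {a} → X a → Simple∈X
    simple {x , ↓} = climb (▷-wellFounded x)
    simple {x , ↑} = descend (▷-noetherian x)

  -- Reversal of closed walks and the conclusion.

  flipStep : Step A → Step A
  flipStep (x , ↓) = x , ↑
  flipStep (x , ↑) = x , ↓

  charge-flip : ∀ a → charge (flipStep a) ≡ flipPol (charge a)
  charge-flip (x , ↓) = refl
  charge-flip (x , ↑) with pol S x
  ... | pos = refl
  ... | neg = refl

  link-flip : ∀ a b → Link a b → Link (flipStep b) (flipStep a)
  link-flip a b (ν , p , q , eq) = ν , trans (tgt-flip b) q , trans (src-flip a) p ,
    trans (charge-flip b) (trans (cong flipPol (sym eq)) (sym (charge-flip a)))
    where
    tgt-flip : ∀ b → tgt A (flipStep b) ≡ src A b
    tgt-flip (_ , ↓) = refl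
    tgt-flip (_ , ↑) = refl
    src-flip : ∀ a → src A (flipStep a) ≡ tgt A a
    src-flip (_ , ↓) = refl
    src-flip (_ , ↑) = refl

  flip-flip : ∀ a → flipStep (flipStep a) ≡ a
  flip-flip (x , ↓) = refl
  flip-flip (x , ↑) = refl

  closed-walk-simple : Normal A → ∀ {a b s} → Walk a b s → Link b a → ∃₂ λ x δ → (x , δ) ∈ s × SimpleEdge A x
  closed-walk-simple normal {a} {b} {s} w close = by-charge (charge a) refl
    where
    succ : ∀ {x} → x ∈ s → ∃ λ y → y ∈ s × Link x y
    succ x∈ with walk-succ w x∈
    ... | inj₁ refl = a , walk-∋head w , close
    ... | inj₂ y    = y
    pred : ∀ {x} → x ∈ s → ∃ λ y → y ∈ s × Link y x
    pred x∈ with walk-pred w x∈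
    ... | inj₁ refl = b , walk-∋last w , close
    ... | inj₂ y    = y
    succ-flip : ∀ {x} → flipStep x ∈ s → ∃ λ y → flipStep y ∈ s × Link x y
    succ-flip {x} x∈ with pred x∈
    ... | y , y∈ , l = flipStep y , subst (_∈ s) (sym (flip-flip y)) y∈ ,
                       subst (λ z → Link z (flipStep y)) (flip-flip x) (link-flip y (flipStep x) l)
    pred-flip : ∀ {x} → flipStep x ∈ s → ∃ λ y → flipStep y ∈ s × Link y x
    pred-flip {x} x∈ with succ x∈
    ... | y , y∈ , l = flipStep y , subst (_∈ s) (sym (flip-flip y)) y∈ ,
                       subst (Link (flipStep y)) (flip-flip x) (link-flip (flipStep x) y l)
    by-charge : ∀ p → charge a ≡ p → ∃₂ λ x δ → (x , δ) ∈ s × SimpleEdge A x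
    by-charge pos eq with Closed.simple normal (_∈ s) succ pred
                            (λ x∈ → trans (sym (walk-charge w x∈)) eq) (walk-∋head w)
    ... | x , x∈ , simp = x , ↓ , x∈ , simp
    -- When the common charge is negative, the reversed steps have positive charge, and reversal
    -- exchanges successors with predecessors.
    by-charge neg eq with Closed.simple normal (λ x → flipStep x ∈ s) succ-flip pred-flip
                            (λ {x} x∈ → subst (λ z → charge z ≡ pos) (flip-flip x)
                              (trans (charge-flip (flipStep x)) (cong flipPol (trans (sym (walk-charge w x∈)) eq))))
                            {flipStep a} (subst (_∈ s) (sym (flip-flip a)) (walk-∋head w))
    ... | x , x∈ , simp = x , ↑ , x∈ , simp

  cycle-fragile : Normal A → ∀ s → AiCycle A s → FragileCycle A s
  cycle-fragile normal s cyc with ai-walk (AiCycle.aipath cyc) | AiCycle.starts cyc | AiCycle.ends cyc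
  ... | a , b , w | t , starts | t′ , ends
    with walk-head (subst (Walk a b) starts w) | walk-last t′ (subst (Walk a b) ends w)
  ... | refl | refl
    -- The charge is constant along the walk, so its last and first steps are linked at the base
    -- vertex of the cycle.
    with closed-walk-simple normal w
           (AiCycle.v cyc , AiCycle.tgt-v cyc , AiCycle.src-v cyc , sym (walk-charge w (walk-∋last w)))
  ... | x , δ , x∈ , simp = cyc , Any.map (λ { refl → simp }) (∈-map⁺ proj₁ x∈)

theorem4p24 : (A : Flow) → Σ Flow λ B → (A →c⋆ B) ×
    ((s : List (Step B)) → AiCycle B s → FragileCycle B s)
-- The proof `≤-refl` sets the bound to one more than the initial total.
theorem4p24 A with normalise _ A (initial-potential (flow-good A)) ≤-refl
... | B , A→B , normal = B , A→B , Cycles.cycle-fragile B normal
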